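{- Let $\gamma \geq 0$ be an integer. The operad $\mathsf{Dias}_\gamma$ admits the following presentation. It is generated by $\mathfrak{G}' = \{\dashv'_a, \vdash'_a : a \in [\gamma]\}$ and its space of relations is generated by $$\dashv'_a \circ_1 \vdash'_{a'} - \vdash'_{a'} \circ_2 \dashv'_a, \qquad a, a' \in [\gamma],$$ $$\vdash'_b \circ_1 \vdash'_a, \qquad \dashv'_b \circ_2 \dashv'_a, \qquad \vdash'_b \circ_1 \dashv'_a, \qquad \dashv'_b \circ_2 \vdash'_a, \qquad a < b \in [\gamma],$$ $$\vdash'_a \circ_1 \vdash'_b - \vdash'_b \circ_2 \vdash'_a, \qquad a < b \in [\gamma],$$ $$\dashv'_b \circ_1 \dashv'_a - \dashv'_a \circ_2 \dashv'_b, \qquad a < b \in [\gamma],$$ $$\vdash'_a \circ_1 \dashv'_b - \vdash'_a \circ_2 \vdash'_b, \qquad a < b \in [\gamma],$$ $$\dashv'_a \circ_1 \dashv'_b - \dashv'_a \circ_2 \vdash'_b, \qquad a < b \in [\gamma],$$ $$\vdash'_a \circ_1 \vdash'_a - \Big(\sum_{a \leq b \in [\gamma]} \vdash'_a \circ_2 \vdash'_b\Big), \qquad a \in [\gamma],$$ $$\Big(\sum_{a \leq b \in [\gamma]} \dashv'_a \circ_1 \dashv'_b\Big) - \dashv'_a \circ_2 \dashv'_a, \qquad a \in [\gamma],$$ $$\vdash'_a \circ_1 \dashv'_a - \Big(\sum_{a \leq b \in [\gamma]} \vdash'_b \circ_2 \vdash'_a\Big), \qquad a \in [\gamma],$$ $$\Big(\sum_{a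 \leq b \in [\gamma]} \dashv'_b \circ_1 \dashv'_a\Big) - \dashv'_a \circ_2 \vdash'_a, \qquad a \in [\gamma].$$
   Context: The ground field has characteristic zero; operad means nonsymmetric operad; $[\gamma] = \{1, \dots, \gamma\}$. $\mathsf{Dias}_\gamma$ is the operad whose component of arity $n \geq 1$ is the linear span of the words of length $n$ on $\{0\} \cup [\gamma]$ with exactly one occurrence of $0$, with $u \circ_i v := u_1 \dots u_{i-1}\, \max(u_i, v_1) \dots \max(u_i, v_m)\, u_{i+1} \dots u_n$ and unit the word $0$. It is generated by the words $0a$ and $a0$, $a \in [\gamma]$; let $\mathfrak{G} = \{\dashv_a, \vdash_a : a \in [\gamma]\}$ be a set of binary symbols, where $\dashv_a$ (resp. $\vdash_a$) stands for $0a$ (resp. $a0$). $\mathbf{Free}(\mathfrak{G})$ is the free operad on $\mathfrak{G}$ (spanned by planar binary trees with internal nodes labeled by $\mathfrak{G}$). In $\mathbf{Free}(\mathfrak{G})(2)$ define $\dashv'_\gamma := \dashv_\gamma$, $\vdash'_\gamma := \vdash_\gamma$, and $\dashv'_a := \dashv_a - \dashv_{a+1}$, $\vdash'_a := \vdash_a - \vdash_{a+1}$ for $a \in [\gamma]$, $a < \gamma$. The family $\mathfrak{G}'$ of these elements is a basis of $\mathbf{Free}(\mathfrak{G})(2)$, so that $\mathbf{Free}(\mathfrak{G})$ is identified with $\mathbf{Free}(\mathfrak{G}')$. An operad $\mathcal{O}$ admits the presentation $(\mathfrak{G}', \mathfrak{R}')$ if $\mathcal{O} \cong \mathbf{Free}(\mathfrak{G}')/\langle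 \mathfrak{R}' \rangle$, where $\langle \mathfrak{R}' \rangle$ is the operad ideal generated by the subspace $\mathfrak{R}'$. -}

module Defs where

open import Algebra.Apartness.Bundles using (HeytingField; module HeytingCommutativeRing)
open import Algebra.Bundles using (CommutativeRing)
import Algebra.Definitions.RawMonoid as RawMonoid
open import Algebra.Module.Bundles using (LeftModule)
open import Algebra.Module.Morphism.Structures using (module LeftModuleMorphisms)
import Algebra.Properties.AbelianGroup as AbelianGroupProperties
import Algebra.Properties.Monoid.Sum as MonoidSum
import Algebra.Construct.NaturalChoice.Max as Max
open import Data.Bool.Base using (if_then_else_)
open import Data.Fin.Base using (Fin; zero; suc; toℕ; fromℕ)
import Data.Fin.Base as Fin
import Data.Fin.Properties as Fin
open import Data.List.Base using (List; []; _∷_; _++_; map; length; filter)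
open import Data.List.Properties
  using (length-++; length-map; filter-++; map-++; map-∘; map-cong; map-id; ++-assoc; ++-identityʳ)
open import Data.Nat.Base using (ℕ; zero; suc; _+_; _∸_; _≤_; _<_; z≤n; s≤s)
open import Data.Nat.Properties
  using ( _≤?_; ≤-trans; ≤-reflexive; <⇒≤; <⇒≱; ≰⇒>; n≤1+n; m≤m+n; m+n∸m≡n; m+[n∸m]≡n
        ; ∸-monoˡ-≤; +-mono-≤; +-monoˡ-≤; +-cancelˡ-<; +-assoc; +-comm; +-suc; suc-injective
        ; ≡-irrelevant)
open import Data.Product.Base using (Σ; Σ-syntax; _×_; _,_; proj₁; proj₂)
open import Level using (Level; _⊔_) renaming (suc to lsuc)
open import Relation.Binary.PropositionalEquality
  using (_≡_; refl; sym; trans; cong; cong₂; subst; module ≡-Reasoning)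
import Relation.Binary.Reasoning.Setoid as ≈-Reasoning
open import Relation.Nullary using (does; yes; no; contradiction)

private
  variable
    c ℓ ℓ₁ ℓ₂ m₁ ℓm₁ m₂ ℓm₂ p : Level

------------------------------------------------------------------------
-- Ground field

groundRing : HeytingField c ℓ₁ ℓ₂ → CommutativeRing c ℓ₁
groundRing K = HeytingCommutativeRing.commutativeRing (HeytingField.heytingCommutativeRing K)

CharacteristicZero : HeytingField c ℓ₁ ℓ₂ → Set ℓ₁
CharacteristicZero K = ∀ n → n · 1# ≈ 0# → n ≡ 0
  where
  open CommutativeRing (groundRing K) using (_≈_; 0#; 1#; +-rawMonoid)
  open RawMonoid +-rawMonoid renaming (_×_ to _·_)

module _ (R : CommutativeRing c ℓ) where

  private
    module R = CommutativeRing R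

  ----------------------------------------------------------------------
  -- Nonsymmetric operads

  -- `component n` is the component of arity `suc n`, and the inputs of an
  -- operation are numbered from 0; so x ∘[ i ] y is x ∘ᵢ₊₁ y, and its arity is
  -- suc m + suc n - 1 = suc (m + n).
  record Operad m ℓm : Set (c ⊔ ℓ ⊔ lsuc (m ⊔ ℓm)) where
    infixl 7 _∘[_]_
    infixl 6 _⊖_

    field
      component : ℕ → LeftModule R.ring m ℓm

    open module Component {n : ℕ} = LeftModule (component n) public
      using ()
      renaming ( _≈ᴹ_ to infix 4 _≈_; _+ᴹ_ to infixl 6 _⊕_; _*ₗ_ to infixr 8 _·_
               ; 0ᴹ to 𝟘; -ᴹ_ to infixr 8 ⊖_)

    Op : ℕ → Set m
    Op n = LeftModule.Carrierᴹ (component n)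

    _⊖_ : ∀ {n} → Op n → Op n → Op n
    x ⊖ y = x ⊕ (⊖ y)

    field
      _∘[_]_ : ∀ {m n} → Op m → Fin (suc m) → Op n → Op (m + n)
      id     : Op 0

      ∘-cong  : ∀ {m n} {x x′ : Op m} (i : Fin (suc m)) {y y′ : Op n} →
                x ≈ x′ → y ≈ y′ → x ∘[ i ] y ≈ x′ ∘[ i ] y′
      ∘-distribʳ : ∀ {m n} (x x′ : Op m) i (y : Op n) →
                   (x ⊕ x′) ∘[ i ] y ≈ (x ∘[ i ] y) ⊕ (x′ ∘[ i ] y)
      ∘-distribˡ : ∀ {m n} (x : Op m) i (y y′ : Op n) →
                   x ∘[ i ] (y ⊕ y′) ≈ (x ∘[ i ] y) ⊕ (x ∘[ i ] y′)
      ∘-scaleˡ : ∀ {m n} k (x : Op m) i (y : Op n) →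
                 (k · x) ∘[ i ] y ≈ k · (x ∘[ i ] y)
      ∘-scaleʳ : ∀ {m n} k (x : Op m) i (y : Op n) →
                 x ∘[ i ] (k · y) ≈ k · (x ∘[ i ] y)

      ∘-sequential : ∀ {m n p} (x : Op m) (y : Op n) (z : Op p)
                     (i : Fin (suc m)) (j : Fin (suc n)) (k : Fin (suc (m + n))) →
                     toℕ k ≡ toℕ i + toℕ j →
                     (eq : (m + n) + p ≡ m + (n + p)) →
                     subst Op eq ((x ∘[ i ] y) ∘[ k ] z) ≈ x ∘[ i ] (y ∘[ j ] z)
      ∘-parallel   : ∀ {m n p} (x : Op m) (y : Op n) (z : Op p)
                     (i j : Fin (suc m)) (i′ : Fin (suc (m + p))) (j′ : Fin (suc (m + n))) →
                     toℕ i < toℕ j → toℕ i′ ≡ toℕ i → toℕ j′ ≡ toℕ j + n →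
                     (eq : (m + n) + p ≡ (m + p) + n) →
                     subst Op eq ((x ∘[ i ] y) ∘[ j′ ] z) ≈ (x ∘[ j ] z) ∘[ i′ ] y
      ∘-identityˡ  : ∀ {n} (x : Op n) → id ∘[ zero ] x ≈ x
      ∘-identityʳ  : ∀ {m} (x : Op m) i (eq : m + 0 ≡ m) →
                     subst Op eq (x ∘[ i ] id) ≈ x

module _ {R : CommutativeRing c ℓ} where

  private
    module R = CommutativeRing R

  record OperadIsomorphism (O : Operad R m₁ ℓm₁) (P : Operad R m₂ ℓm₂)
                           : Set (c ⊔ m₁ ⊔ ℓm₁ ⊔ m₂ ⊔ ℓm₂) where
    private
      module O = Operad O
      module P = Operad P
    field
      to           : ∀ {n} → O.Op n → P.Op n
      isLinearIso  : ∀ n → LeftModuleMorphisms.IsLeftModuleIsomorphism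
                             (LeftModule.rawLeftModule (O.component n))
                             (LeftModule.rawLeftModule (P.component n))
                             (to {n})
      to-∘         : ∀ {m n} (x : O.Op m) i (y : O.Op n) →
                     to (x O.∘[ i ] y) P.≈ to x P.∘[ i ] to y
      to-id        : to O.id P.≈ P.id

  ----------------------------------------------------------------------
  -- Operad ideals and quotients

  record Ideal (O : Operad R m₁ ℓm₁) p : Set (c ⊔ m₁ ⊔ ℓm₁ ⊔ lsuc p) where
    open Operad O
    field
      Mem      : ∀ n → Op n → Set p
      mem-resp : ∀ {n} {x y : Op n} → x ≈ y → Mem n x → Mem n y
      mem-𝟘    : ∀ {n} → Mem n 𝟘
      mem-⊕    : ∀ {n} {x y : Op n} → Mem n x → Mem n y → Mem n (x ⊕ y)
      mem-·    : ∀ {n} k {x : Op n} → Mem n x → Mem n (k · x)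
      mem-∘ˡ   : ∀ {m n} {x : Op m} i (y : Op n) → Mem m x → Mem (m + n) (x ∘[ i ] y)
      mem-∘ʳ   : ∀ {m n} (x : Op m) i {y : Op n} → Mem n y → Mem (m + n) (x ∘[ i ] y)

  module _ {O : Operad R m₁ ℓm₁} where
    open Operad O

    data Generated (S : ∀ n → Op n → Set p) : ∀ n → Op n → Set (c ⊔ m₁ ⊔ ℓm₁ ⊔ p) where
      gen  : ∀ {n} {x : Op n} → S n x → Generated S n x
      resp : ∀ {n} {x y : Op n} → x ≈ y → Generated S n x → Generated S n y
      𝟘∈   : ∀ {n} → Generated S n 𝟘
      ⊕∈   : ∀ {n} {x y : Op n} → Generated S n x → Generated S n y → Generated S n (x ⊕ y)
      ·∈   : ∀ {n} k {x : Op n} → Generated S n x → Generated S n (k · x)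
      ∘ˡ∈  : ∀ {m n} {x : Op m} i (y : Op n) → Generated S m x →
             Generated S (m + n) (x ∘[ i ] y)
      ∘ʳ∈  : ∀ {m n} (x : Op m) i {y : Op n} → Generated S n y →
             Generated S (m + n) (x ∘[ i ] y)

    ⟨_⟩ : (∀ n → Op n → Set p) → Ideal O (c ⊔ m₁ ⊔ ℓm₁ ⊔ p)
    ⟨ S ⟩ = record
      { Mem = Generated S ; mem-resp = resp ; mem-𝟘 = 𝟘∈ ; mem-⊕ = ⊕∈ ; mem-· = ·∈
      ; mem-∘ˡ = ∘ˡ∈ ; mem-∘ʳ = ∘ʳ∈ }

  module _ (O : Operad R m₁ ℓm₁) (I : Ideal O p) where
    open Operad O
    open Ideal I

    private
      module M {n : ℕ} = LeftModule (component n)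
      module G {n : ℕ} = AbelianGroupProperties (M.+ᴹ-abelianGroup {n})

      infix 4 _≋_
      _≋_ : ∀ {n} → Op n → Op n → Set p
      _≋_ {n} x y = Mem n (x ⊖ y)

      -x≈-1·x : ∀ {n} (x : Op n) → (R.- R.1#) · x ≈ ⊖ x
      -x≈-1·x x = G.inverseˡ-unique _ _ (M.≈ᴹ-trans
        (M.+ᴹ-congˡ (M.≈ᴹ-sym (M.*ₗ-identityˡ x)))
        (M.≈ᴹ-trans (M.≈ᴹ-sym (M.*ₗ-distribʳ x _ _))
        (M.≈ᴹ-trans (M.*ₗ-cong (R.-‿inverseˡ R.1#) M.≈ᴹ-refl) (M.*ₗ-zeroˡ x))))

      mem-⊖ : ∀ {n} {x : Op n} → Mem n x → Mem n (⊖ x)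
      mem-⊖ h = mem-resp (-x≈-1·x _) (mem-· (R.- R.1#) h)

      ≈⇒≋ : ∀ {n} {x y : Op n} → x ≈ y → x ≋ y
      ≈⇒≋ {y = y} e = mem-resp (M.≈ᴹ-sym (M.≈ᴹ-trans (M.+ᴹ-congʳ e) (M.-ᴹ‿inverseʳ y))) mem-𝟘

      ≋-sym : ∀ {n} {x y : Op n} → x ≋ y → y ≋ x
      ≋-sym {x = x} {y} h = mem-resp (M.≈ᴹ-trans (G.⁻¹-anti-homo‿- x y) M.≈ᴹ-refl) (mem-⊖ h)

      ≋-trans : ∀ {n} {x y z : Op n} → x ≋ y → y ≋ z → x ≋ z
      ≋-trans {x = x} {y} {z} h k = mem-resp e (mem-⊕ h k)
        where
        open ≈-Reasoning M.≈ᴹ-setoid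
        e : (x ⊖ y) ⊕ (y ⊖ z) ≈ x ⊖ z
        e = begin
          (x ⊖ y) ⊕ (y ⊖ z)     ≈⟨ M.+ᴹ-assoc _ _ _ ⟩
          x ⊕ (⊖ y ⊕ (y ⊖ z))   ≈⟨ M.+ᴹ-congˡ (M.+ᴹ-assoc _ _ _) ⟨
          x ⊕ ((⊖ y ⊕ y) ⊖ z)   ≈⟨ M.+ᴹ-congˡ (M.+ᴹ-congʳ (M.-ᴹ‿inverseˡ y)) ⟩
          x ⊕ (𝟘 ⊖ z)           ≈⟨ M.+ᴹ-congˡ (M.+ᴹ-identityˡ _) ⟩
          x ⊖ z                 ∎

      ⊖-⊕ : ∀ {n} (x x′ y y′ : Op n) → (x ⊖ x′) ⊕ (y ⊖ y′) ≈ (x ⊕ y) ⊖ (x′ ⊕ y′)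
      ⊖-⊕ x x′ y y′ = begin
          (x ⊖ x′) ⊕ (y ⊖ y′)       ≈⟨ M.+ᴹ-assoc _ _ _ ⟩
          x ⊕ (⊖ x′ ⊕ (y ⊖ y′))     ≈⟨ M.+ᴹ-congˡ (M.+ᴹ-assoc _ _ _) ⟨
          x ⊕ ((⊖ x′ ⊕ y) ⊖ y′)     ≈⟨ M.+ᴹ-congˡ (M.+ᴹ-congʳ (M.+ᴹ-comm _ _)) ⟩
          x ⊕ ((y ⊖ x′) ⊖ y′)       ≈⟨ M.+ᴹ-congˡ (M.+ᴹ-assoc _ _ _) ⟩
          x ⊕ (y ⊕ (⊖ x′ ⊖ y′))     ≈⟨ M.+ᴹ-assoc _ _ _ ⟨
          (x ⊕ y) ⊕ (⊖ x′ ⊖ y′)     ≈⟨ M.+ᴹ-congˡ (G.⁻¹-∙-comm x′ y′) ⟩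
          (x ⊕ y) ⊖ (x′ ⊕ y′)       ∎
        where open ≈-Reasoning M.≈ᴹ-setoid

      ≋-⊕ : ∀ {n} {x x′ y y′ : Op n} → x ≋ x′ → y ≋ y′ → x ⊕ y ≋ x′ ⊕ y′
      ≋-⊕ h k = mem-resp (⊖-⊕ _ _ _ _) (mem-⊕ h k)

      ·-⊖ : ∀ {n} k (x : Op n) → k · (⊖ x) ≈ ⊖ (k · x)
      ·-⊖ k x = G.inverseˡ-unique _ _ (M.≈ᴹ-trans (M.≈ᴹ-sym (M.*ₗ-distribˡ k _ _))
        (M.≈ᴹ-trans (M.*ₗ-cong R.refl (M.-ᴹ‿inverseˡ x)) (M.*ₗ-zeroʳ k)))

      ≋-· : ∀ {n k l} {x y : Op n} → k R.≈ l → x ≋ y → k · x ≋ l · y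
      ≋-· {k = k} {l} {x} {y} e h = ≋-trans
        (mem-resp (M.≈ᴹ-trans (M.*ₗ-distribˡ k _ _) (M.+ᴹ-congˡ (·-⊖ k y))) (mem-· k h))
        (≈⇒≋ (M.*ₗ-cong e M.≈ᴹ-refl))

      ∘-⊖ˡ : ∀ {m n} (x : Op m) i (y : Op n) → (⊖ x) ∘[ i ] y ≈ ⊖ (x ∘[ i ] y)
      ∘-⊖ˡ x i y = M.≈ᴹ-trans (∘-cong i (M.≈ᴹ-sym (-x≈-1·x x)) M.≈ᴹ-refl)
        (M.≈ᴹ-trans (∘-scaleˡ _ x i y) (-x≈-1·x _))

      ∘-⊖ʳ : ∀ {m n} (x : Op m) i (y : Op n) → x ∘[ i ] (⊖ y) ≈ ⊖ (x ∘[ i ] y)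
      ∘-⊖ʳ x i y = M.≈ᴹ-trans (∘-cong i M.≈ᴹ-refl (M.≈ᴹ-sym (-x≈-1·x y)))
        (M.≈ᴹ-trans (∘-scaleʳ _ x i y) (-x≈-1·x _))

      ≋-∘ : ∀ {m n} {x x′ : Op m} i {y y′ : Op n} →
            x ≋ x′ → y ≋ y′ → x ∘[ i ] y ≋ x′ ∘[ i ] y′
      ≋-∘ i h k = ≋-trans
        (mem-resp (M.≈ᴹ-trans (∘-distribʳ _ _ i _) (M.+ᴹ-congˡ (∘-⊖ˡ _ i _))) (mem-∘ˡ i _ h))
        (mem-resp (M.≈ᴹ-trans (∘-distribˡ _ i _ _) (M.+ᴹ-congˡ (∘-⊖ʳ _ i _))) (mem-∘ʳ _ i k))

    infixl 6 _/_
    _/_ : Operad R m₁ p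
    _/_ = record
      { component = λ n → record
        { Carrierᴹ = Op n
        ; _≈ᴹ_ = _≋_
        ; _+ᴹ_ = _⊕_
        ; _*ₗ_ = _·_
        ; 0ᴹ = 𝟘
        ; -ᴹ_ = ⊖_
        ; isLeftModule = record
          { isLeftSemimodule = record
            { +ᴹ-isCommutativeMonoid = record
              { isMonoid = record
                { isSemigroup = record
                  { isMagma = record
                    { isEquivalence = record
                      { refl = ≈⇒≋ M.≈ᴹ-refl ; sym = ≋-sym ; trans = ≋-trans }
                    ; ∙-cong = ≋-⊕ }
                  ; assoc = λ x y z → ≈⇒≋ (M.+ᴹ-assoc x y z) }
                ; identity = (λ x → ≈⇒≋ (M.+ᴹ-identityˡ x)) , (λ x → ≈⇒≋ (M.+ᴹ-identityʳ x)) }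
              ; comm = λ x y → ≈⇒≋ (M.+ᴹ-comm x y) }
            ; isPreleftSemimodule = record
              { *ₗ-cong = ≋-·
              ; *ₗ-zeroˡ = λ x → ≈⇒≋ (M.*ₗ-zeroˡ x)
              ; *ₗ-distribʳ = λ x k l → ≈⇒≋ (M.*ₗ-distribʳ x k l)
              ; *ₗ-identityˡ = λ x → ≈⇒≋ (M.*ₗ-identityˡ x)
              ; *ₗ-assoc = λ k l x → ≈⇒≋ (M.*ₗ-assoc k l x)
              ; *ₗ-zeroʳ = λ k → ≈⇒≋ (M.*ₗ-zeroʳ k)
              ; *ₗ-distribˡ = λ k x y → ≈⇒≋ (M.*ₗ-distribˡ k x y) } }
          ; -ᴹ‿cong = λ h → mem-resp (M.≈ᴹ-sym (G.⁻¹-∙-comm _ _)) (mem-⊖ h)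
          ; -ᴹ‿inverse = (λ x → ≈⇒≋ (M.-ᴹ‿inverseˡ x)) , (λ x → ≈⇒≋ (M.-ᴹ‿inverseʳ x)) } }
      ; _∘[_]_ = _∘[_]_
      ; id = id
      ; ∘-cong = ≋-∘
      ; ∘-distribʳ = λ x x′ i y → ≈⇒≋ (∘-distribʳ x x′ i y)
      ; ∘-distribˡ = λ x i y y′ → ≈⇒≋ (∘-distribˡ x i y y′)
      ; ∘-scaleˡ = λ k x i y → ≈⇒≋ (∘-scaleˡ k x i y)
      ; ∘-scaleʳ = λ k x i y → ≈⇒≋ (∘-scaleʳ k x i y)
      ; ∘-sequential = λ x y z i j k e eq → ≈⇒≋ (∘-sequential x y z i j k e eq)
      ; ∘-parallel = λ x y z i j i′ j′ lt e₁ e₂ eq → ≈⇒≋ (∘-parallel x y z i j i′ j′ lt e₁ e₂ eq)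
      ; ∘-identityˡ = λ x → ≈⇒≋ (∘-identityˡ x)
      ; ∘-identityʳ = λ x i eq → ≈⇒≋ (∘-identityʳ x i eq)
      }

------------------------------------------------------------------------
-- Linear spans

module _ (R : CommutativeRing c ℓ) where

  private
    module R = CommutativeRing R

  data Lin (X : Set) : Set c where
    [_]  : X → Lin X
    𝟎    : Lin X
    _⊞_  : Lin X → Lin X → Lin X
    _⊡_  : R.Carrier → Lin X → Lin X

  infixl 6 _⊞_
  infixr 7 _⊡_
  infix 4 _≃_

  -- The congruence generated by the module axioms, so that Lin X / ≃ is the
  -- free module on X.
  data _≃_ {X : Set} : Lin X → Lin X → Set (c ⊔ ℓ) where
    ≃-refl    : ∀ {x} → x ≃ x
    ≃-sym     : ∀ {x y} → x ≃ y → y ≃ x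
    ≃-trans   : ∀ {x y z} → x ≃ y → y ≃ z → x ≃ z
    ⊞-cong    : ∀ {x x′ y y′} → x ≃ x′ → y ≃ y′ → x ⊞ y ≃ x′ ⊞ y′
    ⊡-cong    : ∀ {k k′ x x′} → k R.≈ k′ → x ≃ x′ → k ⊡ x ≃ k′ ⊡ x′
    ⊞-assoc   : ∀ x y z → (x ⊞ y) ⊞ z ≃ x ⊞ (y ⊞ z)
    ⊞-comm    : ∀ x y → x ⊞ y ≃ y ⊞ x
    ⊞-idˡ     : ∀ x → 𝟎 ⊞ x ≃ x
    ⊡-zeroˡ   : ∀ x → R.0# ⊡ x ≃ 𝟎
    ⊡-idˡ     : ∀ x → R.1# ⊡ x ≃ x
    ⊡-assoc   : ∀ k l x → (k R.* l) ⊡ x ≃ k ⊡ l ⊡ x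
    ⊡-distribʳ : ∀ x k l → (k R.+ l) ⊡ x ≃ k ⊡ x ⊞ l ⊡ x
    ⊡-distribˡ : ∀ k x y → k ⊡ (x ⊞ y) ≃ k ⊡ x ⊞ k ⊡ y

  ⊡-zeroʳ : ∀ {X} k → k ⊡ 𝟎 {X} ≃ 𝟎
  ⊡-zeroʳ k = ≃-trans (⊡-cong R.refl (≃-sym (⊡-zeroˡ 𝟎)))
    (≃-trans (≃-sym (⊡-assoc k R.0# 𝟎))
    (≃-trans (⊡-cong (R.zeroʳ k) ≃-refl) (⊡-zeroˡ 𝟎)))

  ⊡-swap : ∀ {X} k l (x : Lin X) → k ⊡ l ⊡ x ≃ l ⊡ k ⊡ x
  ⊡-swap k l x = ≃-trans (≃-sym (⊡-assoc k l x))
    (≃-trans (⊡-cong (R.*-comm k l) ≃-refl) (⊡-assoc l k x))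

  ⊞-invʳ : ∀ {X} (x : Lin X) → x ⊞ (R.- R.1#) ⊡ x ≃ 𝟎
  ⊞-invʳ x = ≃-trans (⊞-cong (≃-sym (⊡-idˡ x)) ≃-refl)
    (≃-trans (≃-sym (⊡-distribʳ x _ _))
    (≃-trans (⊡-cong (R.-‿inverseʳ R.1#) ≃-refl) (⊡-zeroˡ x)))

  linModule : Set → LeftModule R.ring c (c ⊔ ℓ)
  linModule X = record
    { Carrierᴹ = Lin X
    ; _≈ᴹ_ = _≃_
    ; _+ᴹ_ = _⊞_
    ; _*ₗ_ = _⊡_
    ; 0ᴹ = 𝟎
    ; -ᴹ_ = λ x → (R.- R.1#) ⊡ x
    ; isLeftModule = record
      { isLeftSemimodule = record
        { +ᴹ-isCommutativeMonoid = record
          { isMonoid = record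
            { isSemigroup = record
              { isMagma = record
                { isEquivalence = record { refl = ≃-refl ; sym = ≃-sym ; trans = ≃-trans }
                ; ∙-cong = ⊞-cong }
              ; assoc = ⊞-assoc }
            ; identity = ⊞-idˡ , λ x → ≃-trans (⊞-comm x 𝟎) (⊞-idˡ x) }
          ; comm = ⊞-comm }
        ; isPreleftSemimodule = record
          { *ₗ-cong = ⊡-cong
          ; *ₗ-zeroˡ = ⊡-zeroˡ
          ; *ₗ-distribʳ = ⊡-distribʳ
          ; *ₗ-identityˡ = ⊡-idˡ
          ; *ₗ-assoc = ⊡-assoc
          ; *ₗ-zeroʳ = ⊡-zeroʳ
          ; *ₗ-distribˡ = ⊡-distribˡ } }
      ; -ᴹ‿cong = ⊡-cong R.refl
      ; -ᴹ‿inverse = (λ x → ≃-trans (⊞-comm _ x) (⊞-invʳ x)) , ⊞-invʳ } }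

  module _ (M : LeftModule R.ring m₁ ℓm₁) {X : Set} where
    private
      module M = LeftModule M

    linearExtension : (X → M.Carrierᴹ) → Lin X → M.Carrierᴹ
    linearExtension f [ x ]   = f x
    linearExtension f 𝟎       = M.0ᴹ
    linearExtension f (x ⊞ y) = linearExtension f x M.+ᴹ linearExtension f y
    linearExtension f (k ⊡ x) = k M.*ₗ linearExtension f x

    linearExtension-cong : ∀ f {x y} → x ≃ y → linearExtension f x M.≈ᴹ linearExtension f y
    linearExtension-cong f ≃-refl = M.≈ᴹ-refl
    linearExtension-cong f (≃-sym e) = M.≈ᴹ-sym (linearExtension-cong f e)
    linearExtension-cong f (≃-trans e e′) =
      M.≈ᴹ-trans (linearExtension-cong f e) (linearExtension-cong f e′)
    linearExtension-cong f (⊞-cong e e′) =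
      M.+ᴹ-cong (linearExtension-cong f e) (linearExtension-cong f e′)
    linearExtension-cong f (⊡-cong e e′) = M.*ₗ-cong e (linearExtension-cong f e′)
    linearExtension-cong f (⊞-assoc x y z) = M.+ᴹ-assoc _ _ _
    linearExtension-cong f (⊞-comm x y) = M.+ᴹ-comm _ _
    linearExtension-cong f (⊞-idˡ x) = M.+ᴹ-identityˡ _
    linearExtension-cong f (⊡-zeroˡ x) = M.*ₗ-zeroˡ _
    linearExtension-cong f (⊡-idˡ x) = M.*ₗ-identityˡ _
    linearExtension-cong f (⊡-assoc k l x) = M.*ₗ-assoc _ _ _
    linearExtension-cong f (⊡-distribʳ x k l) = M.*ₗ-distribʳ _ _ _
    linearExtension-cong f (⊡-distribˡ k x y) = M.*ₗ-distribˡ _ _ _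

------------------------------------------------------------------------
-- Operads in sets and their linearizations

record SetOperad : Set₁ where
  field
    X      : ℕ → Set
    _∘[_]_ : ∀ {m n} → X m → Fin (suc m) → X n → X (m + n)
    id     : X 0
    ∘-sequential : ∀ {m n p} (x : X m) (y : X n) (z : X p)
                   (i : Fin (suc m)) (j : Fin (suc n)) (k : Fin (suc (m + n))) →
                   toℕ k ≡ toℕ i + toℕ j →
                   (eq : (m + n) + p ≡ m + (n + p)) →
                   subst X eq ((x ∘[ i ] y) ∘[ k ] z) ≡ x ∘[ i ] (y ∘[ j ] z)
    ∘-parallel   : ∀ {m n p} (x : X m) (y : X n) (z : X p)
                   (i j : Fin (suc m)) (i′ : Fin (suc (m + p))) (j′ : Fin (suc (m + n))) →
                   toℕ i < toℕ j → toℕ i′ ≡ toℕ i → toℕ j′ ≡ toℕ j + n →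
                   (eq : (m + n) + p ≡ (m + p) + n) →
                   subst X eq ((x ∘[ i ] y) ∘[ j′ ] z) ≡ (x ∘[ j ] z) ∘[ i′ ] y
    ∘-identityˡ  : ∀ {n} (x : X n) → id ∘[ zero ] x ≡ x
    ∘-identityʳ  : ∀ {m} (x : X m) i (eq : m + 0 ≡ m) →
                   subst X eq (x ∘[ i ] id) ≡ x

module _ (R : CommutativeRing c ℓ) (P : SetOperad) where
  private
    module R = CommutativeRing R
    module P = SetOperad P
    L : ℕ → Set c
    L n = Lin R (P.X n)

    infix 4 _≈_
    _≈_ : ∀ {X : Set} → Lin R X → Lin R X → Set (c ⊔ ℓ)
    _≈_ = _≃_ R

    infixl 7 _∘[_]_
    _∘[_]_ : ∀ {m n} → L m → Fin (suc m) → L n → L (m + n)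
    x ∘[ i ] y = linearExtension R (linModule R _)
      (λ a → linearExtension R (linModule R _) (λ b → [ a P.∘[ i ] b ]) y) x

    ∘-distribˡ : ∀ {m n} (x : L m) i (y y′ : L n) →
                 x ∘[ i ] (y ⊞ y′) ≈ (x ∘[ i ] y) ⊞ (x ∘[ i ] y′)
    ∘-distribˡ [ x ] i y y′ = ≃-refl
    ∘-distribˡ 𝟎 i y y′ = ≃-sym (⊞-idˡ 𝟎)
    ∘-distribˡ (x ⊞ x′) i y y′ = ≃-trans (⊞-cong (∘-distribˡ x i y y′) (∘-distribˡ x′ i y y′))
      (≃-trans (⊞-assoc _ _ _)
      (≃-trans (⊞-cong ≃-refl (≃-trans (≃-sym (⊞-assoc _ _ _))
        (≃-trans (⊞-cong (⊞-comm _ _) ≃-refl) (⊞-assoc _ _ _))))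
      (≃-sym (⊞-assoc _ _ _))))
    ∘-distribˡ (k ⊡ x) i y y′ =
      ≃-trans (⊡-cong R.refl (∘-distribˡ x i y y′)) (⊡-distribˡ k _ _)

    ∘-scaleʳ : ∀ {m n} k (x : L m) i (y : L n) → x ∘[ i ] (k ⊡ y) ≈ k ⊡ (x ∘[ i ] y)
    ∘-scaleʳ k [ x ] i y = ≃-refl
    ∘-scaleʳ k 𝟎 i y = ≃-sym (⊡-zeroʳ R k)
    ∘-scaleʳ k (x ⊞ x′) i y =
      ≃-trans (⊞-cong (∘-scaleʳ k x i y) (∘-scaleʳ k x′ i y)) (≃-sym (⊡-distribˡ k _ _))
    ∘-scaleʳ k (l ⊡ x) i y =
      ≃-trans (⊡-cong R.refl (∘-scaleʳ k x i y)) (⊡-swap R l k _)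

    ∘-zeroʳ : ∀ {m n} (x : L m) i → x ∘[ i ] (𝟎 {X = P.X n}) ≈ 𝟎
    ∘-zeroʳ [ x ] i = ≃-refl
    ∘-zeroʳ 𝟎 i = ≃-refl
    ∘-zeroʳ (x ⊞ x′) i = ≃-trans (⊞-cong (∘-zeroʳ x i) (∘-zeroʳ x′ i)) (⊞-idˡ 𝟎)
    ∘-zeroʳ (l ⊡ x) i = ≃-trans (⊡-cong R.refl (∘-zeroʳ x i)) (⊡-zeroʳ R l)

    ∘-congʳ : ∀ {m n} (x : L m) i {y y′ : L n} → y ≈ y′ → x ∘[ i ] y ≈ x ∘[ i ] y′
    ∘-congʳ [ x ] i e = linearExtension-cong R (linModule R _) _ e
    ∘-congʳ 𝟎 i e = ≃-refl
    ∘-congʳ (x ⊞ x′) i e = ⊞-cong (∘-congʳ x i e) (∘-congʳ x′ i e)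
    ∘-congʳ (l ⊡ x) i e = ⊡-cong R.refl (∘-congʳ x i e)

    ∘-cong : ∀ {m n} {x x′ : L m} i {y y′ : L n} →
             x ≈ x′ → y ≈ y′ → x ∘[ i ] y ≈ x′ ∘[ i ] y′
    ∘-cong {x′ = x′} i e e′ =
      ≃-trans (linearExtension-cong R (linModule R _) _ e) (∘-congʳ x′ i e′)

    module _ {m n : ℕ} where
      subst-[] : (eq : m ≡ n) (a : P.X m) → subst L eq [ a ] ≡ [ subst P.X eq a ]
      subst-[] refl a = refl

      subst-𝟎 : (eq : m ≡ n) → subst L eq 𝟎 ≡ 𝟎
      subst-𝟎 refl = refl

      subst-⊞ : (eq : m ≡ n) (x y : L m) → subst L eq (x ⊞ y) ≡ subst L eq x ⊞ subst L eq y
      subst-⊞ refl x y = refl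

      subst-⊡ : (eq : m ≡ n) (k : R.Carrier) (x : L m) →
                subst L eq (k ⊡ x) ≡ k ⊡ subst L eq x
      subst-⊡ refl k x = refl

    ≡⇒≈ : ∀ {X} {x y : Lin R X} → x ≡ y → x ≈ y
    ≡⇒≈ refl = ≃-refl

    via𝟎 : ∀ {m n} (eq : m ≡ n) {z : L n} → 𝟎 ≈ z → subst L eq 𝟎 ≈ z
    via𝟎 eq e = ≃-trans (≡⇒≈ (subst-𝟎 eq)) e

    via⊞ : ∀ {m n} (eq : m ≡ n) {x y : L m} {x′ y′ z : L n} →
           subst L eq x ≈ x′ → subst L eq y ≈ y′ → x′ ⊞ y′ ≈ z → subst L eq (x ⊞ y) ≈ z
    via⊞ eq e e′ f = ≃-trans (≡⇒≈ (subst-⊞ eq _ _)) (≃-trans (⊞-cong e e′) f)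

    via⊡ : ∀ {m n} (eq : m ≡ n) {k} {x : L m} {x′ z : L n} →
           subst L eq x ≈ x′ → k ⊡ x′ ≈ z → subst L eq (k ⊡ x) ≈ z
    via⊡ eq e f = ≃-trans (≡⇒≈ (subst-⊡ eq _ _)) (≃-trans (⊡-cong R.refl e) f)

    module _ {m n p : ℕ} (i : Fin (suc m)) (j : Fin (suc n)) (k : Fin (suc (m + n)))
             (e : toℕ k ≡ toℕ i + toℕ j) (eq : (m + n) + p ≡ m + (n + p)) where

      sequential : (x : L m) (y : L n) (z : L p) →
                   subst L eq ((x ∘[ i ] y) ∘[ k ] z) ≈ x ∘[ i ] (y ∘[ j ] z)
      sequential 𝟎 y z = via𝟎 eq ≃-refl
      sequential (x ⊞ x′) y z = via⊞ eq (sequential x y z) (sequential x′ y z) ≃-refl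
      sequential (l ⊡ x) y z = via⊡ eq (sequential x y z) ≃-refl
      sequential [ x ] 𝟎 z = via𝟎 eq ≃-refl
      sequential [ x ] (y ⊞ y′) z = via⊞ eq (sequential [ x ] y z) (sequential [ x ] y′ z) ≃-refl
      sequential [ x ] (l ⊡ y) z = via⊡ eq (sequential [ x ] y z) ≃-refl
      sequential [ x ] [ y ] 𝟎 = via𝟎 eq ≃-refl
      sequential [ x ] [ y ] (z ⊞ z′) =
        via⊞ eq (sequential [ x ] [ y ] z) (sequential [ x ] [ y ] z′) ≃-refl
      sequential [ x ] [ y ] (l ⊡ z) = via⊡ eq (sequential [ x ] [ y ] z) ≃-refl
      sequential [ x ] [ y ] [ z ] =
        ≡⇒≈ (trans (subst-[] eq _) (cong [_] (P.∘-sequential x y z i j k e eq)))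

    module _ {m n p : ℕ} (i j : Fin (suc m)) (i′ : Fin (suc (m + p))) (j′ : Fin (suc (m + n)))
             (lt : toℕ i < toℕ j) (e : toℕ i′ ≡ toℕ i) (e′ : toℕ j′ ≡ toℕ j + n)
             (eq : (m + n) + p ≡ (m + p) + n) where

      parallel : (x : L m) (y : L n) (z : L p) →
                 subst L eq ((x ∘[ i ] y) ∘[ j′ ] z) ≈ (x ∘[ j ] z) ∘[ i′ ] y
      parallel 𝟎 y z = via𝟎 eq ≃-refl
      parallel (x ⊞ x′) y z = via⊞ eq (parallel x y z) (parallel x′ y z) ≃-refl
      parallel (l ⊡ x) y z = via⊡ eq (parallel x y z) ≃-refl
      parallel [ x ] 𝟎 z = via𝟎 eq (≃-sym (∘-zeroʳ ([ x ] ∘[ j ] z) i′))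
      parallel [ x ] (y ⊞ y′) z = via⊞ eq (parallel [ x ] y z) (parallel [ x ] y′ z)
        (≃-sym (∘-distribˡ ([ x ] ∘[ j ] z) i′ y y′))
      parallel [ x ] (l ⊡ y) z = via⊡ eq (parallel [ x ] y z)
        (≃-sym (∘-scaleʳ l ([ x ] ∘[ j ] z) i′ y))
      parallel [ x ] [ y ] 𝟎 = via𝟎 eq ≃-refl
      parallel [ x ] [ y ] (z ⊞ z′) =
        via⊞ eq (parallel [ x ] [ y ] z) (parallel [ x ] [ y ] z′) ≃-refl
      parallel [ x ] [ y ] (l ⊡ z) = via⊡ eq (parallel [ x ] [ y ] z) ≃-refl
      parallel [ x ] [ y ] [ z ] =
        ≡⇒≈ (trans (subst-[] eq _) (cong [_] (P.∘-parallel x y z i j i′ j′ lt e e′ eq)))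

    identityˡ : ∀ {n} (x : L n) → [ P.id ] ∘[ zero ] x ≈ x
    identityˡ [ x ] = ≡⇒≈ (cong [_] (P.∘-identityˡ x))
    identityˡ 𝟎 = ≃-refl
    identityˡ (x ⊞ y) = ⊞-cong (identityˡ x) (identityˡ y)
    identityˡ (k ⊡ x) = ⊡-cong R.refl (identityˡ x)

    identityʳ : ∀ {m} (x : L m) i (eq : m + 0 ≡ m) → subst L eq (x ∘[ i ] [ P.id ]) ≈ x
    identityʳ [ x ] i eq = ≡⇒≈ (trans (subst-[] eq _) (cong [_] (P.∘-identityʳ x i eq)))
    identityʳ 𝟎 i eq = via𝟎 eq ≃-refl
    identityʳ (x ⊞ y) i eq = via⊞ eq (identityʳ x i eq) (identityʳ y i eq) ≃-refl
    identityʳ (k ⊡ x) i eq = via⊡ eq (identityʳ x i eq) ≃-refl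

  linearize : Operad R c (c ⊔ ℓ)
  linearize = record
    { component = λ n → linModule R (P.X n)
    ; _∘[_]_ = _∘[_]_
    ; id = [ P.id ]
    ; ∘-cong = ∘-cong
    ; ∘-distribʳ = λ x x′ i y → ≃-refl
    ; ∘-distribˡ = ∘-distribˡ
    ; ∘-scaleˡ = λ k x i y → ≃-refl
    ; ∘-scaleʳ = ∘-scaleʳ
    ; ∘-sequential = λ x y z i j k e eq → sequential i j k e eq x y z
    ; ∘-parallel = λ x y z i j i′ j′ lt e e′ eq → parallel i j i′ j′ lt e e′ eq x y z
    ; ∘-identityˡ = identityˡ
    ; ∘-identityʳ = identityʳ
    }

Σ-prop-≡ : ∀ {A : Set} {P : A → Set} → (∀ {x} (p q : P x) → p ≡ q) →
           {x y : Σ A P} → proj₁ x ≡ proj₁ y → x ≡ y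
Σ-prop-≡ irr {x , p} {.x , q} refl = cong (x ,_) (irr p q)

proj₁-subst : ∀ {A : Set} (P : ℕ → A → Set) {m n} (eq : m ≡ n) (x : Σ A (P m)) →
              proj₁ (subst (λ k → Σ A (P k)) eq x) ≡ proj₁ x
proj₁-subst P refl x = refl

------------------------------------------------------------------------
-- Free operads on binary generators

data BinTree (G : Set) : Set where
  leaf : BinTree G
  node : G → BinTree G → BinTree G → BinTree G

-- Number of internal nodes; a tree has one more leaf than internal nodes.
nodes : ∀ {G} → BinTree G → ℕ
nodes leaf         = 0
nodes (node g l r) = suc (nodes l + nodes r)

-- graft t i s replaces the leaf number i of t (from the left, starting at 0)
-- by s.
graft : ∀ {G} → BinTree G → ℕ → BinTree G → BinTree G
graft leaf i s = s
graft (node g l r) i s with i ≤? nodes l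
... | yes _ = node g (graft l i s) r
... | no  _ = node g l (graft r (i ∸ suc (nodes l)) s)

module _ {G : Set} where

  private
    graft-left : ∀ g (l r : BinTree G) {i} s → i ≤ nodes l →
                 graft (node g l r) i s ≡ node g (graft l i s) r
    graft-left g l r {i} s h with i ≤? nodes l
    ... | yes _ = refl
    ... | no ¬h = contradiction h ¬h

    graft-right : ∀ g (l r : BinTree G) i s →
                  graft (node g l r) (suc (nodes l) + i) s ≡ node g l (graft r i s)
    graft-right g l r i s with suc (nodes l) + i ≤? nodes l
    ... | yes h = contradiction h (<⇒≱ (s≤s (m≤m+n (nodes l) i)))
    ... | no _  = cong (λ k → node g l (graft r k s)) (m+n∸m≡n (suc (nodes l)) i)

    data Side (a b : ℕ) : ℕ → Set where
      left  : ∀ {i} → i ≤ a → Side a b i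
      right : ∀ i → i ≤ b → Side a b (suc a + i)

    side : ∀ a b i → i ≤ suc (a + b) → Side a b i
    side a b i h with i ≤? a
    ... | yes i≤a = left i≤a
    ... | no  i≰a = subst (Side a b) (m+[n∸m]≡n a<i)
      (right (i ∸ suc a) (≤-trans (∸-monoˡ-≤ (suc a) h) (≤-reflexive (m+n∸m≡n a b))))
      where
      a<i : a < i
      a<i = ≰⇒> i≰a

  nodes-graft : ∀ (t : BinTree G) i s → nodes (graft t i s) ≡ nodes t + nodes s
  nodes-graft leaf i s = refl
  nodes-graft (node g l r) i s with i ≤? nodes l
  ... | yes _ = cong suc (begin
    nodes (graft l i s) + nodes r   ≡⟨ cong (_+ nodes r) (nodes-graft l i s) ⟩
    nodes l + nodes s + nodes r     ≡⟨ +-assoc (nodes l) _ _ ⟩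
    nodes l + (nodes s + nodes r)   ≡⟨ cong (nodes l +_) (+-comm (nodes s) _) ⟩
    nodes l + (nodes r + nodes s)   ≡⟨ +-assoc (nodes l) _ _ ⟨
    nodes l + nodes r + nodes s     ∎)
    where open ≡-Reasoning
  ... | no _ = cong suc (trans (cong (nodes l +_) (nodes-graft r _ s))
                               (sym (+-assoc (nodes l) _ _)))

  graft-sequential : ∀ (t : BinTree G) i s j u → i ≤ nodes t → j ≤ nodes s →
                     graft (graft t i s) (i + j) u ≡ graft t i (graft s j u)
  graft-sequential leaf .0 s j u z≤n hj = refl
  graft-sequential (node g l r) i s j u hi hj with side (nodes l) (nodes r) i hi
  ... | left h = begin
    graft (graft (node g l r) i s) (i + j) u   ≡⟨ cong (λ t → graft t (i + j) u) (graft-left g l r s h) ⟩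
    graft (node g (graft l i s) r) (i + j) u   ≡⟨ graft-left g _ r u h′ ⟩
    node g (graft (graft l i s) (i + j) u) r   ≡⟨ cong (λ t → node g t r) (graft-sequential l i s j u h hj) ⟩
    node g (graft l i (graft s j u)) r         ≡⟨ graft-left g l r _ h ⟨
    graft (node g l r) i (graft s j u)         ∎
    where
    open ≡-Reasoning
    h′ : i + j ≤ nodes (graft l i s)
    h′ = ≤-trans (+-mono-≤ h hj) (≤-reflexive (sym (nodes-graft l i s)))
  ... | right i h = begin
    graft (graft (node g l r) (suc (nodes l) + i) s) (suc (nodes l) + i + j) u
      ≡⟨ cong₂ (λ t k → graft t k u) (graft-right g l r i s) (+-assoc (suc (nodes l)) i j) ⟩
    graft (node g l (graft r i s)) (suc (nodes l) + (i + j)) u   ≡⟨ graft-right g l _ (i + j) u ⟩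
    node g l (graft (graft r i s) (i + j) u)   ≡⟨ cong (node g l) (graft-sequential r i s j u h hj) ⟩
    node g l (graft r i (graft s j u))         ≡⟨ graft-right g l r i _ ⟨
    graft (node g l r) (suc (nodes l) + i) (graft s j u)   ∎
    where open ≡-Reasoning

  graft-parallel : ∀ (t : BinTree G) i j s u → i < j → j ≤ nodes t →
                   graft (graft t i s) (j + nodes s) u ≡ graft (graft t j u) i s
  graft-parallel leaf i .0 s u () z≤n
  graft-parallel (node g l r) i j s u i<j hj
    with side (nodes l) (nodes r) i (≤-trans (<⇒≤ i<j) hj) | side (nodes l) (nodes r) j hj
  ... | left hi | left hj = begin
    graft (graft (node g l r) i s) (j + nodes s) u
      ≡⟨ cong (λ t → graft t (j + nodes s) u) (graft-left g l r s hi) ⟩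
    graft (node g (graft l i s) r) (j + nodes s) u
      ≡⟨ graft-left g _ r u (≤-trans (+-monoˡ-≤ (nodes s) hj) (≤-reflexive (sym (nodes-graft l i s)))) ⟩
    node g (graft (graft l i s) (j + nodes s) u) r
      ≡⟨ cong (λ t → node g t r) (graft-parallel l i j s u i<j hj) ⟩
    node g (graft (graft l j u) i s) r
      ≡⟨ graft-left g _ r s (≤-trans hi (≤-trans (m≤m+n _ (nodes u)) (≤-reflexive (sym (nodes-graft l j u))))) ⟨
    graft (node g (graft l j u) r) i s
      ≡⟨ cong (λ t → graft t i s) (graft-left g l r u hj) ⟨
    graft (graft (node g l r) j u) i s   ∎
    where open ≡-Reasoning
  ... | left hi | right j hj = begin
    graft (graft (node g l r) i s) (suc (nodes l) + j + nodes s) u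
      ≡⟨ cong₂ (λ t k → graft t k u) (graft-left g l r s hi) e ⟩
    graft (node g (graft l i s) r) (suc (nodes (graft l i s)) + j) u
      ≡⟨ graft-right g _ r j u ⟩
    node g (graft l i s) (graft r j u)
      ≡⟨ graft-left g l _ s hi ⟨
    graft (node g l (graft r j u)) i s
      ≡⟨ cong (λ t → graft t i s) (graft-right g l r j u) ⟨
    graft (graft (node g l r) (suc (nodes l) + j) u) i s   ∎
    where
    open ≡-Reasoning
    e : suc (nodes l) + j + nodes s ≡ suc (nodes (graft l i s)) + j
    e = cong suc (begin
      nodes l + j + nodes s       ≡⟨ +-assoc (nodes l) j _ ⟩
      nodes l + (j + nodes s)     ≡⟨ cong (nodes l +_) (+-comm j _) ⟩
      nodes l + (nodes s + j)     ≡⟨ +-assoc (nodes l) _ j ⟨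
      nodes l + nodes s + j       ≡⟨ cong (_+ j) (nodes-graft l i s) ⟨
      nodes (graft l i s) + j     ∎)
  ... | right i hi | left hj =
    contradiction (≤-trans i<j hj) (<⇒≱ (≤-trans (s≤s (m≤m+n (nodes l) i)) (n≤1+n _)))
  ... | right i hi | right j hj = begin
    graft (graft (node g l r) (suc (nodes l) + i) s) (suc (nodes l) + j + nodes s) u
      ≡⟨ cong₂ (λ t k → graft t k u) (graft-right g l r i s) (+-assoc (suc (nodes l)) j _) ⟩
    graft (node g l (graft r i s)) (suc (nodes l) + (j + nodes s)) u
      ≡⟨ graft-right g l _ _ u ⟩
    node g l (graft (graft r i s) (j + nodes s) u)
      ≡⟨ cong (node g l) (graft-parallel r i j s u (+-cancelˡ-< (suc (nodes l)) i j i<j) hj) ⟩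
    node g l (graft (graft r j u) i s)
      ≡⟨ graft-right g l _ i s ⟨
    graft (node g l (graft r j u)) (suc (nodes l) + i) s
      ≡⟨ cong (λ t → graft t (suc (nodes l) + i) s) (graft-right g l r j u) ⟨
    graft (graft (node g l r) (suc (nodes l) + j) u) (suc (nodes l) + i) s   ∎
    where open ≡-Reasoning

  graft-leaf : ∀ (t : BinTree G) i → graft t i leaf ≡ t
  graft-leaf leaf i = refl
  graft-leaf (node g l r) i with i ≤? nodes l
  ... | yes _ = cong (λ t → node g t r) (graft-leaf l i)
  ... | no  _ = cong (node g l) (graft-leaf r _)

Tree : Set → ℕ → Set
Tree G n = Σ[ t ∈ BinTree G ] nodes t ≡ n

module _ (G : Set) where

  private
    pos : ∀ {m} {t : BinTree G} → nodes t ≡ m → (i : Fin (suc m)) → toℕ i ≤ nodes t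
    pos refl i = Fin.toℕ≤pred[n] i

    tree-≡ : ∀ {n} {x y : Tree G n} → proj₁ x ≡ proj₁ y → x ≡ y
    tree-≡ = Σ-prop-≡ ≡-irrelevant

    proj₁-tree : ∀ {m n} (eq : m ≡ n) (x : Tree G m) → proj₁ (subst (Tree G) eq x) ≡ proj₁ x
    proj₁-tree = proj₁-subst (λ n t → nodes t ≡ n)

  treeOperad : SetOperad
  treeOperad = record
    { X = Tree G
    ; _∘[_]_ = λ (t , p) i (s , q) → graft t (toℕ i) s , trans (nodes-graft t (toℕ i) s) (cong₂ _+_ p q)
    ; id = leaf , refl
    ; ∘-sequential = λ (t , p) (s , q) (u , _) i j k e eq → tree-≡ (trans (proj₁-tree eq _)
        (trans (cong (λ k → graft (graft t (toℕ i) s) k u) e)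
               (graft-sequential t (toℕ i) s (toℕ j) u (pos p i) (pos q j))))
    ; ∘-parallel = λ { (t , p) (s , refl) (u , _) i j i′ j′ lt e e′ eq → tree-≡ (trans (proj₁-tree eq _)
        (trans (cong (λ k → graft (graft t (toℕ i) s) k u) e′)
        (trans (graft-parallel t (toℕ i) (toℕ j) s u lt (pos p j))
               (cong (λ k → graft (graft t (toℕ j) u) k s) (sym e))))) }
    ; ∘-identityˡ = λ x → tree-≡ refl
    ; ∘-identityʳ = λ (t , p) i eq → tree-≡ (trans (proj₁-tree eq _) (graft-leaf t (toℕ i)))
    }

corolla : ∀ {G} → G → Tree G 1
corolla g = node g leaf leaf , refl

Free : (R : CommutativeRing c ℓ) → Set → Operad R c (c ⊔ ℓ)
Free R G = linearize R (treeOperad G)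

module _ (R : CommutativeRing c ℓ) {G : Set} where

  generator : G → Operad.Op (Free R G) 1
  generator g = [ corolla g ]

module _ {R : CommutativeRing c ℓ} {G : Set} where

  -- The operad morphism from the free operad determined by the images of the
  -- generators.
  module _ (O : Operad R m₁ ℓm₁) (f : G → Operad.Op O 1) where
    open Operad O

    evalTree : (t : BinTree G) → Op (nodes t)
    evalTree leaf         = id
    evalTree (node g l r) = (f g ∘[ zero ] evalTree l) ∘[ fromℕ (suc (nodes l)) ] evalTree r

    eval : ∀ {n} → Operad.Op (Free R G) n → Op n
    eval {n} = linearExtension R (component n) (λ (t , eq) → subst Op eq (evalTree t))

-- O is presented by the generators G, standing for the elements `f g` of O,
-- and the space of relations spanned by S.
AdmitsPresentation : (R : CommutativeRing c ℓ) (O : Operad R m₁ ℓm₁) {G : Set}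
                     (f : G → Operad.Op O 1)
                     (S : ∀ n → Operad.Op (Free R G) n → Set p) →
                     Set (c ⊔ ℓ ⊔ m₁ ⊔ ℓm₁ ⊔ p)
AdmitsPresentation R O {G} f S =
  Σ[ φ ∈ OperadIsomorphism (Free R G / ⟨ S ⟩) O ]
    (∀ g → Operad._≈_ O (OperadIsomorphism.to φ (generator R g)) (f g))

------------------------------------------------------------------------
-- The pluriassociative operads

-- The letter 0 is `zero`, and the letter a ∈ [γ] is the successor of the
-- corresponding element of Fin γ.
Letter : ℕ → Set
Letter γ = Fin (suc γ)

module _ {γ : ℕ} where
  open Max (Fin.≤-totalOrder (suc γ)) public
    using () renaming (_⊔_ to infixl 6 _⊔ᴸ_)
  open Max (Fin.≤-totalOrder (suc γ))
    using (x≤y⇒x⊔y≈y; ⊔-assoc; ⊔-comm; x≤x⊔y)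

  zeros : List (Letter γ) → ℕ
  zeros w = length (filter (Fin._≟ zero) w)

  -- insert u i v is u₁…uᵢ₋₁ max(uᵢ, v₁)…max(uᵢ, vₘ) uᵢ₊₁…uₙ, with positions
  -- counted from 0.
  insert : List (Letter γ) → ℕ → List (Letter γ) → List (Letter γ)
  insert []      i       v = []
  insert (x ∷ u) zero    v = map (x ⊔ᴸ_) v ++ u
  insert (x ∷ u) (suc i) v = x ∷ insert u i v

  private
    map-0⊔ : ∀ v → map (zero ⊔ᴸ_) v ≡ v
    map-0⊔ v = trans (map-cong (λ x → x≤y⇒x⊔y≈y {x} {zero} z≤n) v) (map-id v)

    ⊔-zeroʳ : ∀ x → x ⊔ᴸ zero ≡ x
    ⊔-zeroʳ x = trans (⊔-comm x zero) (x≤y⇒x⊔y≈y {x} {zero} z≤n)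

    zeros-++ : ∀ u v → zeros (u ++ v) ≡ zeros u + zeros v
    zeros-++ u v = trans (cong length (filter-++ (Fin._≟ zero) u v)) (length-++ (filter (Fin._≟ zero) u))

    zeros-suc⊔ : ∀ a v → zeros (map (suc a ⊔ᴸ_) v) ≡ 0
    zeros-suc⊔ a [] = refl
    zeros-suc⊔ a (x ∷ v) with suc a ⊔ᴸ x in eq
    ... | suc _ = zeros-suc⊔ a v
    ... | zero  = contradiction (subst (suc a Fin.≤_) eq (x≤x⊔y (suc a) x)) λ ()

  length-insert : ∀ u i v → i < length u → suc (length (insert u i v)) ≡ length u + length v
  length-insert (x ∷ u) zero v h = cong suc (trans (length-++ (map (x ⊔ᴸ_) v))
    (trans (cong (_+ length u) (length-map _ v)) (+-comm (length v) _)))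
  length-insert (x ∷ u) (suc i) v (s≤s h) = cong suc (length-insert u i v h)

  zeros-insert : ∀ u i v → i < length u → zeros v ≡ 1 → zeros (insert u i v) ≡ zeros u
  zeros-insert (zero ∷ u) zero v h e = trans (zeros-++ (map (zero ⊔ᴸ_) v) u)
    (cong (_+ zeros u) (trans (cong zeros (map-0⊔ v)) e))
  zeros-insert (suc a ∷ u) zero v h e = trans (zeros-++ (map (suc a ⊔ᴸ_) v) u)
    (cong (_+ zeros u) (zeros-suc⊔ a v))
  zeros-insert (zero ∷ u) (suc i) v (s≤s h) e = cong suc (zeros-insert u i v h e)
  zeros-insert (suc a ∷ u) (suc i) v (s≤s h) e = zeros-insert u i v h e

  private
    insert-++ : ∀ v u j w → j < length v → insert (v ++ u) j w ≡ insert v j w ++ u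
    insert-++ (x ∷ v) u zero w h = sym (++-assoc (map (x ⊔ᴸ_) w) v u)
    insert-++ (x ∷ v) u (suc j) w (s≤s h) = cong (x ∷_) (insert-++ v u j w h)

    insert-++ʳ : ∀ v u j w → insert (v ++ u) (length v + j) w ≡ v ++ insert u j w
    insert-++ʳ [] u j w = refl
    insert-++ʳ (x ∷ v) u j w = cong (x ∷_) (insert-++ʳ v u j w)

    insert-map : ∀ x v j w → insert (map (x ⊔ᴸ_) v) j w ≡ map (x ⊔ᴸ_) (insert v j w)
    insert-map x [] j w = refl
    insert-map x (y ∷ v) zero w = begin
      map ((x ⊔ᴸ y) ⊔ᴸ_) w ++ map (x ⊔ᴸ_) v
        ≡⟨ cong (_++ map (x ⊔ᴸ_) v) (trans (map-cong (⊔-assoc x y) w) (map-∘ w)) ⟩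
      map (x ⊔ᴸ_) (map (y ⊔ᴸ_) w) ++ map (x ⊔ᴸ_) v
        ≡⟨ map-++ (x ⊔ᴸ_) (map (y ⊔ᴸ_) w) v ⟨
      map (x ⊔ᴸ_) (map (y ⊔ᴸ_) w ++ v)   ∎
      where open ≡-Reasoning
    insert-map x (y ∷ v) (suc j) w = cong (x ⊔ᴸ y ∷_) (insert-map x v j w)

  insert-sequential : ∀ u i v j w → j < length v →
                      insert (insert u i v) (i + j) w ≡ insert u i (insert v j w)
  insert-sequential [] i v j w h = refl
  insert-sequential (x ∷ u) zero v j w h =
    trans (insert-++ (map (x ⊔ᴸ_) v) u j w (subst (j <_) (sym (length-map _ v)) h))
          (cong (_++ u) (insert-map x v j w))
  insert-sequential (x ∷ u) (suc i) v j w h = cong (x ∷_) (insert-sequential u i v j w h)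

  insert-parallel : ∀ u i j v w n → length v ≡ suc n → i < j →
                    insert (insert u i v) (j + n) w ≡ insert (insert u j w) i v
  insert-parallel [] i j v w n e h = refl
  insert-parallel (x ∷ u) zero (suc j) v w n e h =
    trans (cong (λ k → insert (map (x ⊔ᴸ_) v ++ u) k w)
            (trans (+-comm (suc j) n) (trans (+-suc n j)
              (cong (_+ j) (sym (trans (length-map (x ⊔ᴸ_) v) e))))))
          (insert-++ʳ (map (x ⊔ᴸ_) v) u j w)
  insert-parallel (x ∷ u) (suc i) (suc j) v w n e (s≤s h) =
    cong (x ∷_) (insert-parallel u i j v w n e h)

  insert-identityʳ : ∀ u i → insert u i (zero ∷ []) ≡ u
  insert-identityʳ [] i = refl
  insert-identityʳ (x ∷ u) zero = cong (_∷ u) (⊔-zeroʳ x)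
  insert-identityʳ (x ∷ u) (suc i) = cong (x ∷_) (insert-identityʳ u i)

  insert-identityˡ : ∀ v → insert (zero ∷ []) 0 v ≡ v
  insert-identityˡ v = trans (++-identityʳ _) (map-0⊔ v)

Word : ℕ → ℕ → Set
Word γ n = Σ[ w ∈ List (Letter γ) ] length w ≡ suc n × zeros w ≡ 1

module _ (γ : ℕ) where

  private
    pos : ∀ {m} {u : List (Letter γ)} → length u ≡ suc m → (i : Fin (suc m)) → toℕ i < length u
    pos {u = u} e i = subst (toℕ i <_) (sym e) (Fin.toℕ<n i)

    word-≡ : ∀ {n} {x y : Word γ n} → proj₁ x ≡ proj₁ y → x ≡ y
    word-≡ = Σ-prop-≡ λ (p , q) (p′ , q′) → cong₂ _,_ (≡-irrelevant p p′) (≡-irrelevant q q′)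

    proj₁-word : ∀ {m n} (eq : m ≡ n) (x : Word γ m) → proj₁ (subst (Word γ) eq x) ≡ proj₁ x
    proj₁-word = proj₁-subst (λ n w → length w ≡ suc n × zeros w ≡ 1)

  wordOperad : SetOperad
  wordOperad = record
    { X = Word γ
    ; _∘[_]_ = λ {m} {n} (u , p , q) i (v , p′ , q′) →
        insert u (toℕ i) v ,
        suc-injective (trans (length-insert u (toℕ i) v (pos {u = u} p i))
                             (trans (cong₂ _+_ p p′) (cong suc (+-suc m n)))) ,
        trans (zeros-insert u (toℕ i) v (pos {u = u} p i) q′) q
    ; id = zero ∷ [] , refl , refl
    ; ∘-sequential = λ (u , _) (v , p , _) (w , _) i j k e eq → word-≡ (trans (proj₁-word eq _)
        (trans (cong (λ k → insert (insert u (toℕ i) v) k w) e)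
               (insert-sequential u (toℕ i) v (toℕ j) w (pos {u = v} p j))))
    ; ∘-parallel = λ (u , _) (v , p , _) (w , _) i j i′ j′ lt e e′ eq → word-≡ (trans (proj₁-word eq _)
        (trans (cong (λ k → insert (insert u (toℕ i) v) k w) e′)
        (trans (insert-parallel u (toℕ i) (toℕ j) v w _ p lt)
               (cong (λ k → insert (insert u (toℕ j) w) k v) (sym e)))))
    ; ∘-identityˡ = λ (v , _) → word-≡ (insert-identityˡ v)
    ; ∘-identityʳ = λ (u , _) i eq → word-≡ (trans (proj₁-word eq _) (insert-identityʳ u (toℕ i)))
    }

Dias : (R : CommutativeRing c ℓ) → ℕ → Operad R c (c ⊔ ℓ)
Dias R γ = linearize R (wordOperad γ)

data 𝔊 (γ : ℕ) : Set where
  ⊣ ⊢ : Fin γ → 𝔊 γ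

data 𝔊′ (γ : ℕ) : Set where
  ⊣′ ⊢′ : Fin γ → 𝔊′ γ

word : ∀ {γ} → 𝔊 γ → Word γ 1
word (⊣ a) = zero ∷ suc a ∷ [] , refl , refl
word (⊢ a) = suc a ∷ zero ∷ [] , refl , refl

module _ (R : CommutativeRing c ℓ) {γ : ℕ} where

  private
    module F = Operad (Free R (𝔊 γ))
    module F′ = Operad (Free R (𝔊′ γ))

  -- xₐ - xₐ₊₁, with the convention that the term after the last one is 0.
  differences : ∀ {n} → (Fin n → F.Op 1) → Fin n → F.Op 1
  differences {suc zero}    x zero    = x zero
  differences {suc (suc n)} x zero    = x zero F.⊖ x (suc zero)
  differences {suc n}       x (suc a) = differences (λ b → x (suc b)) a

  -- The elements ⊣′ₐ and ⊢′ₐ of the free operad on 𝔊.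
  primed : 𝔊′ γ → F.Op 1
  primed (⊣′ a) = differences (λ b → generator R (⊣ b)) a
  primed (⊢′ a) = differences (λ b → generator R (⊢ b)) a

  stands-for : 𝔊 γ → Operad.Op (Dias R γ) 1
  stands-for g = [ word g ]

  open F′ using (_⊖_)
  open MonoidSum (LeftModule.+ᴹ-monoid (F′.component 2)) using (sum)

  infix 7 _∘₁_ _∘₂_
  _∘₁_ _∘₂_ : 𝔊′ γ → 𝔊′ γ → F′.Op 2
  g ∘₁ h = generator R g F′.∘[ zero ] generator R h
  g ∘₂ h = generator R g F′.∘[ suc zero ] generator R h

  -- The sum of x b over all b ≥ a in [γ].
  ∑≥ : Fin γ → (Fin γ → F′.Op 2) → F′.Op 2
  ∑≥ a x = sum λ b → if does (a Fin.≤? b) then x b else F′.𝟘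

  data ℜ′ : ∀ n → F′.Op n → Set c where
    ⊣∘₁⊢-⊢∘₂⊣ : ∀ a a′ → ℜ′ 2 (⊣′ a ∘₁ ⊢′ a′ ⊖ ⊢′ a′ ∘₂ ⊣′ a)

    ⊢∘₁⊢-null : ∀ {a b} → a Fin.< b → ℜ′ 2 (⊢′ b ∘₁ ⊢′ a)
    ⊣∘₂⊣-null : ∀ {a b} → a Fin.< b → ℜ′ 2 (⊣′ b ∘₂ ⊣′ a)
    ⊢∘₁⊣-null : ∀ {a b} → a Fin.< b → ℜ′ 2 (⊢′ b ∘₁ ⊣′ a)
    ⊣∘₂⊢-null : ∀ {a b} → a Fin.< b → ℜ′ 2 (⊣′ b ∘₂ ⊢′ a)

    ⊢∘₁⊢-⊢∘₂⊢ : ∀ {a b} → a Fin.< b → ℜ′ 2 (⊢′ a ∘₁ ⊢′ b ⊖ ⊢′ b ∘₂ ⊢′ a)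
    ⊣∘₁⊣-⊣∘₂⊣ : ∀ {a b} → a Fin.< b → ℜ′ 2 (⊣′ b ∘₁ ⊣′ a ⊖ ⊣′ a ∘₂ ⊣′ b)
    ⊢∘₁⊣-⊢∘₂⊢ : ∀ {a b} → a Fin.< b → ℜ′ 2 (⊢′ a ∘₁ ⊣′ b ⊖ ⊢′ a ∘₂ ⊢′ b)
    ⊣∘₁⊣-⊣∘₂⊢ : ∀ {a b} → a Fin.< b → ℜ′ 2 (⊣′ a ∘₁ ⊣′ b ⊖ ⊣′ a ∘₂ ⊢′ b)

    ⊢∘₁⊢-∑⊢∘₂⊢ : ∀ a → ℜ′ 2 (⊢′ a ∘₁ ⊢′ a ⊖ ∑≥ a (λ b → ⊢′ a ∘₂ ⊢′ b))
    ∑⊣∘₁⊣-⊣∘₂⊣ : ∀ a → ℜ′ 2 (∑≥ a (λ b → ⊣′ a ∘₁ ⊣′ b) ⊖ ⊣′ a ∘₂ ⊣′ a)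
    ⊢∘₁⊣-∑⊢∘₂⊢ : ∀ a → ℜ′ 2 (⊢′ a ∘₁ ⊣′ a ⊖ ∑≥ a (λ b → ⊢′ b ∘₂ ⊢′ a))
    ∑⊣∘₁⊣-⊣∘₂⊢ : ∀ a → ℜ′ 2 (∑≥ a (λ b → ⊣′ b ∘₁ ⊣′ a) ⊖ ⊣′ a ∘₂ ⊢′ a)

module Submission where

-- In terms of the tail sums ⊣ₐ = ∑_{b ≥ a} ⊣′_b and ⊢ₐ = ∑_{b ≥ a} ⊢′_b the relations are
-- monomial; for instance, the three relations that rewrite ⊢′ ∘₁ ⊢′ together say that
-- ⊢_b ∘₁ ⊢_a = ⊢_{max(a,b)} ∘₂ ⊢_b. These monomial relations visibly hold in Dias, so
-- evaluation factors through the quotient. They also rewrite any tree to a right comb of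
-- ⊢'s (the letters before 0) over a left comb of ⊣'s (the letters after 0), that is, to a
-- word. Sending a word to its comb thus defines a linear map from Dias to the quotient
-- that commutes with the products by the generators, and it is inverse to evaluation.

open import Defs
open import Algebra.Apartness.Bundles using (HeytingField)
open import Algebra.Bundles using (CommutativeRing; Ring)
import Algebra.Construct.NaturalChoice.Max as Max
open import Algebra.Module.Bundles using (LeftModule)
open import Algebra.Module.Morphism.Structures using (module LeftModuleMorphisms)
import Algebra.Properties.AbelianGroup as AbelianGroupProperties
import Algebra.Properties.Monoid.Sum as MonoidSum
open import Data.Bool.Base using (if_then_else_)
open import Data.Fin.Base using (Fin; zero; suc; toℕ; fromℕ)
import Data.Fin.Base as Fin
import Data.Fin.Properties as Fin
open import Data.List.Base using (List; []; _∷_; _++_; map; length)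
open import Data.List.Properties using (length-map; ++-identityʳ; ++-assoc)
open import Data.Nat.Base using (ℕ; zero; suc; _+_; _∸_; _≤_; _<_; _⊔_; z≤n; s≤s)
open import Data.Nat.Properties
open import Data.Product.Base using (Σ; Σ-syntax; _×_; _,_; proj₁; proj₂)
open import Data.Sum.Base using (_⊎_; inj₁; inj₂)
open import Function.Base using (_∘_)
open import Level using (Level) renaming (_⊔_ to _⊔ˡ_)
open import Relation.Binary.PropositionalEquality
  using (_≡_; refl; sym; trans; cong; cong₂; subst; module ≡-Reasoning)
import Relation.Binary.Reasoning.Setoid as ≈-Reasoning
open import Relation.Nullary using (does; yes; no; contradiction)

-- The passage between the given relations and the monomial ones is a fact about square arrays of
-- vectors. In four groups of relations, composites whose labels are in one strict order vanish,
-- those in the other order become one composite each, and a diagonal one absorbs a whole tail.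
-- Summing over tails turns this pattern into one rule with a max; differencing tail sums recovers
-- the pattern. Both directions are used, in different operads: from monomial to given relations in
-- Dias, where words can be computed, and back in the quotient, where only the given relations are
-- available.
--
-- The normal form is defined on words, not by rewriting trees. Rewriting enters only to show that a
-- product of two normal forms by a generator is the normal form of the product word. Every tree is
-- an iterated product by generators, so this already makes normalization a left inverse of
-- evaluation on the quotient.
--
-- Arities of iterated composites agree only up to a proof in ℕ; hence the heterogeneous relation
-- `_≅_`.

private
  variable
    c ℓ m ℓm m′ ℓm′ r ℓr : Level

-- Tail sums and triangular systems of relations

toℕ-view : ∀ n k → (Σ[ a ∈ Fin n ] toℕ a ≡ k) ⊎ n ≤ k
toℕ-view n k with k <? n
... | yes k<n = inj₁ (Fin.fromℕ< k<n , Fin.toℕ-fromℕ< k<n)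
... | no  k≮n = inj₂ (≮⇒≥ k≮n)

-- Equalities of tail sums are proved from the far end, where the sums are empty. `P` ranges over
-- all of ℕ, so the successor of the last index falls under the base case.
downward-induction : ∀ {n p} (P : ℕ → Set p) → (∀ k → n ≤ k → P k) →
                     (∀ (a : Fin n) → P (suc (toℕ a)) → P (toℕ a)) → ∀ k → P k
downward-induction {zero}  P base step k = base k z≤n
downward-induction {suc n} {p} P base step = λ where
    zero    → step zero (shifted zero)
    (suc k) → shifted k
  where
  shifted : ∀ k → P (suc k)
  shifted = downward-induction (λ k → P (suc k)) (λ k h → base (suc k) (s≤s h)) (step ∘ suc)

module TailSums {R : Ring r ℓr} (M : LeftModule R m ℓm) where
  open LeftModule M
  open AbelianGroupProperties +ᴹ-abelianGroup using (∙-cancelˡ; ∙-cancelʳ)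
  open MonoidSum +ᴹ-monoid using (sum)
  open ≈-Reasoning ≈ᴹ-setoid

  private
    variable
      n : ℕ

  -- The start of the tail is a natural number: the tail after the last index is then an ordinary
  -- empty sum, and `tailSum-step` has no exceptional case.
  tailSum : (Fin n → Carrierᴹ) → ℕ → Carrierᴹ
  tailSum {zero}  x k       = 0ᴹ
  tailSum {suc n} x zero    = x zero +ᴹ tailSum (x ∘ suc) zero
  tailSum {suc n} x (suc k) = tailSum (x ∘ suc) k

  tailSum-cong : ∀ {x y : Fin n → Carrierᴹ} → (∀ a → x a ≈ᴹ y a) → ∀ k → tailSum x k ≈ᴹ tailSum y k
  tailSum-cong {zero}  e k       = ≈ᴹ-refl
  tailSum-cong {suc n} e zero    = +ᴹ-cong (e zero) (tailSum-cong (e ∘ suc) zero)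
  tailSum-cong {suc n} e (suc k) = tailSum-cong (e ∘ suc) k

  tailSum-step : ∀ (x : Fin n → Carrierᴹ) a → tailSum x (toℕ a) ≈ᴹ x a +ᴹ tailSum x (suc (toℕ a))
  tailSum-step x zero    = ≈ᴹ-refl
  tailSum-step x (suc a) = tailSum-step (x ∘ suc) a

  tailSum-≥ : ∀ (x : Fin n → Carrierᴹ) {k} → n ≤ k → tailSum x k ≈ᴹ 0ᴹ
  tailSum-≥ {zero}  x h       = ≈ᴹ-refl
  tailSum-≥ {suc n} x (s≤s h) = tailSum-≥ (x ∘ suc) h

  tailSum-0 : ∀ {x : Fin n → Carrierᴹ} → (∀ a → x a ≈ᴹ 0ᴹ) → ∀ k → tailSum x k ≈ᴹ 0ᴹ
  tailSum-0 {n} {x} e = downward-induction _ (λ k → tailSum-≥ x) λ a h →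
    ≈ᴹ-trans (tailSum-step x a) (≈ᴹ-trans (+ᴹ-cong (e a) h) (+ᴹ-identityˡ 0ᴹ))

  tailSum-injective : ∀ {x y : Fin n → Carrierᴹ} → (∀ k → tailSum x k ≈ᴹ tailSum y k) → ∀ a → x a ≈ᴹ y a
  tailSum-injective {x = x} {y} e a = ∙-cancelʳ (tailSum x (suc (toℕ a))) _ _ (begin
    x a +ᴹ tailSum x (suc (toℕ a))   ≈⟨ tailSum-step x a ⟨
    tailSum x (toℕ a)                ≈⟨ e (toℕ a) ⟩
    tailSum y (toℕ a)                ≈⟨ tailSum-step y a ⟩
    y a +ᴹ tailSum y (suc (toℕ a))   ≈⟨ +ᴹ-congˡ (e (suc (toℕ a))) ⟨
    y a +ᴹ tailSum x (suc (toℕ a))   ∎)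

  sum-guarded : ∀ (x : Fin n → Carrierᴹ) (a : Fin n) →
                sum (λ b → if does (a Fin.≤? b) then x b else 0ᴹ) ≈ᴹ tailSum x (toℕ a)
  sum-guarded x zero = all x
    where
    all : ∀ {n} (x : Fin n → Carrierᴹ) → sum x ≈ᴹ tailSum x 0
    all {zero}  x = ≈ᴹ-refl
    all {suc n} x = +ᴹ-congˡ (all (x ∘ suc))
  -- The comparison under `does` computes on two successors only once the predecessor on the left is
  -- itself a constructor; hence the further split of the index.
  sum-guarded x (suc zero)    = ≈ᴹ-trans (+ᴹ-identityˡ _) (sum-guarded (x ∘ suc) zero)
  sum-guarded x (suc (suc a)) = ≈ᴹ-trans (+ᴹ-identityˡ _) (sum-guarded (x ∘ suc) (suc a))

  -- The shape common to four of the five groups of relations: P c d is the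
  -- composite to be rewritten, and T x y the composite rewritten to.
  record Triangular (P T : Fin n → Fin n → Carrierᴹ) : Set ℓm where
    field
      below    : ∀ {c d} → d Fin.< c → P c d ≈ᴹ 0ᴹ
      above    : ∀ {c d} → c Fin.< d → P c d ≈ᴹ T d c
      diagonal : ∀ a → P a a ≈ᴹ tailSum (T a) (toℕ a)

  -- For `P c d` equal to `x c ∘[ i ] y d`, bilinearity makes this a monomial relation between tail
  -- sums.
  MaxRule : (P T : Fin n → Fin n → Carrierᴹ) → ℕ → ℕ → Set ℓm
  MaxRule P T k l = tailSum (λ d → tailSum (λ c → P c d) k) l ≈ᴹ
                    tailSum (λ d → tailSum (T d) k) (l ⊔ k)

  -- Past the last label both sides are empty sums. These extra instances are what differencing at
  -- the last label refers to.
  maxRule-extend : ∀ {P T : Fin n → Fin n → Carrierᴹ} →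
                   (∀ b a → MaxRule P T (toℕ b) (toℕ a)) → ∀ k l → MaxRule P T k l
  maxRule-extend {n} {P} {T} h k l with toℕ-view n k | toℕ-view n l
  ... | inj₁ (b , refl) | inj₁ (a , refl) = h b a
  ... | inj₂ n≤k        | _               = ≈ᴹ-trans
    (tailSum-0 (λ d → tailSum-≥ (λ c → P c d) n≤k) l)
    (≈ᴹ-sym (tailSum-≥ (λ d → tailSum (T d) k) (≤-trans n≤k (m≤n⊔m l k))))
  ... | _               | inj₂ n≤l        = ≈ᴹ-trans
    (tailSum-≥ (λ d → tailSum (λ c → P c d) k) n≤l)
    (≈ᴹ-sym (tailSum-≥ (λ d → tailSum (T d) k) (≤-trans n≤l (m≤m⊔n l k))))

  module _ {P T : Fin n → Fin n → Carrierᴹ} where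

    private
      F : Fin n → ℕ → Carrierᴹ
      F d k = tailSum (λ c → P c d) k

      G : Fin n → ℕ → Carrierᴹ
      G d k = tailSum (T d) k

    module _ (tri : Triangular P T) where
      open Triangular tri

      -- In column `d` the entries with `c > d` vanish, the diagonal entry supplies the terms
      -- `T d b` for all `b ≥ d`, and each entry with `c < d` supplies `T d c`. A tail that includes
      -- the diagonal is therefore the same tail of row `d` of `T`.
      columns : ∀ d k → (toℕ d < k → F d k ≈ᴹ 0ᴹ) × (k ≤ toℕ d → F d k ≈ᴹ G d k)
      columns d = downward-induction _
        (λ k n≤k → (λ _ → tailSum-≥ (λ c → P c d) n≤k) ,
                   (λ k≤d → contradiction (Fin.toℕ<n d) (≤⇒≯ (≤-trans n≤k k≤d))))
        λ c (after , before) →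
          (λ d<c → begin
            F d (toℕ c)                  ≈⟨ tailSum-step _ c ⟩
            P c d +ᴹ F d (suc (toℕ c))   ≈⟨ +ᴹ-cong (below d<c) (after (m<n⇒m<1+n d<c)) ⟩
            0ᴹ +ᴹ 0ᴹ                     ≈⟨ +ᴹ-identityˡ 0ᴹ ⟩
            0ᴹ                           ∎) ,
          (λ c≤d → ≈ᴹ-trans (tailSum-step _ c) (at c after before (m≤n⇒m<n∨m≡n c≤d)))
        where
        at : ∀ c → (toℕ d < suc (toℕ c) → F d (suc (toℕ c)) ≈ᴹ 0ᴹ) →
             (suc (toℕ c) ≤ toℕ d → F d (suc (toℕ c)) ≈ᴹ G d (suc (toℕ c))) →
             toℕ c < toℕ d ⊎ toℕ c ≡ toℕ d → P c d +ᴹ F d (suc (toℕ c)) ≈ᴹ G d (toℕ c)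
        at c after before (inj₁ c<d) = begin
          P c d +ᴹ F d (suc (toℕ c))   ≈⟨ +ᴹ-cong (above c<d) (before c<d) ⟩
          T d c +ᴹ G d (suc (toℕ c))   ≈⟨ tailSum-step (T d) c ⟨
          G d (toℕ c)                  ∎
        at c after before (inj₂ c≡d) with Fin.toℕ-injective c≡d
        ... | refl = begin
          P c c +ᴹ F c (suc (toℕ c))   ≈⟨ +ᴹ-cong (diagonal c) (after (n<1+n (toℕ c))) ⟩
          G c (toℕ c) +ᴹ 0ᴹ            ≈⟨ +ᴹ-identityʳ _ ⟩
          G c (toℕ c)                  ∎

      -- By `columns`, of the columns `d ≥ l` only those with `d ≥ k` contribute; this is where the
      -- max comes from.
      triangular⇒maxRule : ∀ k l → MaxRule P T k l
      triangular⇒maxRule k = downward-induction _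
        (λ l n≤l → ≈ᴹ-trans (tailSum-≥ _ n≤l) (≈ᴹ-sym (tailSum-≥ _ (≤-trans n≤l (m≤m⊔n l k)))))
        step
        where
        step : ∀ d → MaxRule P T k (suc (toℕ d)) → MaxRule P T k (toℕ d)
        step d ih with k ≤? toℕ d
        ... | yes k≤d = begin
          tailSum (λ d → F d k) (toℕ d)                   ≈⟨ tailSum-step _ d ⟩
          F d k +ᴹ tailSum (λ d → F d k) (suc (toℕ d))    ≈⟨ +ᴹ-cong (proj₂ (columns d k) k≤d) ih ⟩
          G d k +ᴹ tailSum (λ d → G d k) (suc (toℕ d) ⊔ k)
            ≡⟨ cong (λ j → G d k +ᴹ tailSum (λ d → G d k) j) (m≥n⇒m⊔n≡m (m≤n⇒m≤1+n k≤d)) ⟩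
          G d k +ᴹ tailSum (λ d → G d k) (suc (toℕ d))    ≈⟨ tailSum-step _ d ⟨
          tailSum (λ d → G d k) (toℕ d)
            ≡⟨ cong (tailSum (λ d → G d k)) (m≥n⇒m⊔n≡m k≤d) ⟨
          tailSum (λ d → G d k) (toℕ d ⊔ k)               ∎
        ... | no k≰d = begin
          tailSum (λ d → F d k) (toℕ d)                   ≈⟨ tailSum-step _ d ⟩
          F d k +ᴹ tailSum (λ d → F d k) (suc (toℕ d))    ≈⟨ +ᴹ-cong (proj₁ (columns d k) d<k) ih ⟩
          0ᴹ +ᴹ tailSum (λ d → G d k) (suc (toℕ d) ⊔ k)   ≈⟨ +ᴹ-identityˡ _ ⟩
          tailSum (λ d → G d k) (suc (toℕ d) ⊔ k)
            ≡⟨ cong (tailSum (λ d → G d k)) (trans (m≤n⇒m⊔n≡n d<k) (sym (m≤n⇒m⊔n≡n (<⇒≤ d<k)))) ⟩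
          tailSum (λ d → G d k) (toℕ d ⊔ k)               ∎
          where
          d<k : toℕ d < k
          d<k = ≰⇒> k≰d

    module _ (rule : ∀ k l → MaxRule P T k l) where

      -- Comparing the rule at `d` and at `suc d` isolates column `d`. For `d < k` both maxima are
      -- `k`, so nothing is left.
      column-below : ∀ d k → toℕ d < k → F d k ≈ᴹ 0ᴹ
      column-below d k d<k = ∙-cancelʳ (tailSum (λ d → F d k) (suc (toℕ d))) _ _ (begin
        F d k +ᴹ tailSum (λ d → F d k) (suc (toℕ d))   ≈⟨ tailSum-step _ d ⟨
        tailSum (λ d → F d k) (toℕ d)                  ≈⟨ rule k (toℕ d) ⟩
        tailSum (λ d → G d k) (toℕ d ⊔ k)
          ≡⟨ cong (tailSum (λ d → G d k)) (trans (m≤n⇒m⊔n≡n (<⇒≤ d<k)) (sym (m≤n⇒m⊔n≡n d<k))) ⟩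
        tailSum (λ d → G d k) (suc (toℕ d) ⊔ k)        ≈⟨ rule k (suc (toℕ d)) ⟨
        tailSum (λ d → F d k) (suc (toℕ d))            ≈⟨ +ᴹ-identityˡ _ ⟨
        0ᴹ +ᴹ tailSum (λ d → F d k) (suc (toℕ d))      ∎)

      column-above : ∀ d k → k ≤ toℕ d → F d k ≈ᴹ G d k
      column-above d k k≤d = ∙-cancelʳ (tailSum (λ d → F d k) (suc (toℕ d))) _ _ (begin
        F d k +ᴹ tailSum (λ d → F d k) (suc (toℕ d))   ≈⟨ tailSum-step _ d ⟨
        tailSum (λ d → F d k) (toℕ d)                  ≈⟨ rule k (toℕ d) ⟩
        tailSum (λ d → G d k) (toℕ d ⊔ k)
          ≡⟨ cong (tailSum (λ d → G d k)) (m≥n⇒m⊔n≡m k≤d) ⟩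
        tailSum (λ d → G d k) (toℕ d)                  ≈⟨ tailSum-step _ d ⟩
        G d k +ᴹ tailSum (λ d → G d k) (suc (toℕ d))
          ≡⟨ cong (λ j → G d k +ᴹ tailSum (λ d → G d k) j) (m≥n⇒m⊔n≡m (m≤n⇒m≤1+n k≤d)) ⟨
        G d k +ᴹ tailSum (λ d → G d k) (suc (toℕ d) ⊔ k)   ≈⟨ +ᴹ-congˡ (rule k (suc (toℕ d))) ⟨
        G d k +ᴹ tailSum (λ d → F d k) (suc (toℕ d))   ∎)

      -- A second difference, in the start of an isolated column, isolates an entry. On the diagonal
      -- the rest of the column is already zero.
      maxRule⇒triangular : Triangular P T
      maxRule⇒triangular = record
        { below = λ {c} {d} d<c → ∙-cancelʳ (F d (suc (toℕ c))) _ _ (begin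
            P c d +ᴹ F d (suc (toℕ c))   ≈⟨ tailSum-step _ c ⟨
            F d (toℕ c)                  ≈⟨ column-below d (toℕ c) d<c ⟩
            0ᴹ                           ≈⟨ column-below d (suc (toℕ c)) (m<n⇒m<1+n d<c) ⟨
            F d (suc (toℕ c))            ≈⟨ +ᴹ-identityˡ _ ⟨
            0ᴹ +ᴹ F d (suc (toℕ c))      ∎)
        ; above = λ {c} {d} c<d → ∙-cancelʳ (F d (suc (toℕ c))) _ _ (begin
            P c d +ᴹ F d (suc (toℕ c))   ≈⟨ tailSum-step _ c ⟨
            F d (toℕ c)                  ≈⟨ column-above d (toℕ c) (<⇒≤ c<d) ⟩
            G d (toℕ c)                  ≈⟨ tailSum-step _ c ⟩
            T d c +ᴹ G d (suc (toℕ c))   ≈⟨ +ᴹ-congˡ (column-above d (suc (toℕ c)) c<d) ⟨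
            T d c +ᴹ F d (suc (toℕ c))   ∎)
        ; diagonal = λ a → begin
            P a a                        ≈⟨ +ᴹ-identityʳ _ ⟨
            P a a +ᴹ 0ᴹ                  ≈⟨ +ᴹ-congˡ (column-below a (suc (toℕ a)) (n<1+n (toℕ a))) ⟨
            P a a +ᴹ F a (suc (toℕ a))   ≈⟨ tailSum-step _ a ⟨
            F a (toℕ a)                  ≈⟨ column-above a (toℕ a) ≤-refl ⟩
            G a (toℕ a)                  ∎
        }

module _ {R : Ring r ℓr} {M : LeftModule R m ℓm} {N : LeftModule R m′ ℓm′} where
  private
    module M = LeftModule M
    module N = LeftModule N
    module ΣM = TailSums M
    module ΣN = TailSums N

  tailSum-hom : ∀ {n} (f : M.Carrierᴹ → N.Carrierᴹ) → f M.0ᴹ N.≈ᴹ N.0ᴹ →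
                (∀ x y → f (x M.+ᴹ y) N.≈ᴹ f x N.+ᴹ f y) →
                ∀ (x : Fin n → M.Carrierᴹ) k → f (ΣM.tailSum x k) N.≈ᴹ ΣN.tailSum (f ∘ x) k
  tailSum-hom {zero}  f f0 f+ x k       = f0
  tailSum-hom {suc n} f f0 f+ x zero    =
    N.≈ᴹ-trans (f+ _ _) (N.+ᴹ-congˡ (tailSum-hom f f0 f+ (x ∘ suc) zero))
  tailSum-hom {suc n} f f0 f+ x (suc k) = tailSum-hom f f0 f+ (x ∘ suc) k

-- Composition in an operad, up to equality of arities

module OperadProperties {R : CommutativeRing c ℓ} (O : Operad R m ℓm) where
  open Operad O public
  module Comp {n : ℕ} = LeftModule (component n)
  open Comp public using (≈ᴹ-refl; ≈ᴹ-sym; ≈ᴹ-trans; ≈ᴹ-reflexive; +ᴹ-cong; *ₗ-cong; *ₗ-zeroˡ)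
  open module Sums {n : ℕ} = TailSums (component n) public
  private
    module R = CommutativeRing R
    variable
      k l n p q : ℕ

  ∘-zeroˡ : ∀ i (y : Op n) → 𝟘 {p} ∘[ i ] y ≈ 𝟘
  ∘-zeroˡ i y = ≈ᴹ-trans (∘-cong i (≈ᴹ-sym (*ₗ-zeroˡ 𝟘)) ≈ᴹ-refl)
    (≈ᴹ-trans (∘-scaleˡ R.0# 𝟘 i y) (*ₗ-zeroˡ _))

  ∘-zeroʳ : ∀ (x : Op p) i → x ∘[ i ] 𝟘 {n} ≈ 𝟘
  ∘-zeroʳ x i = ≈ᴹ-trans (∘-cong i ≈ᴹ-refl (≈ᴹ-sym (*ₗ-zeroˡ 𝟘)))
    (≈ᴹ-trans (∘-scaleʳ R.0# x i 𝟘) (*ₗ-zeroˡ _))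

  tailSum-∘ˡ : ∀ (x : Fin k → Op p) i (y : Op n) j →
               tailSum x j ∘[ i ] y ≈ tailSum (λ a → x a ∘[ i ] y) j
  tailSum-∘ˡ {p = p} {n} x i y = tailSum-hom {M = component p} {N = component (p + n)}
    (_∘[ i ] y) (∘-zeroˡ i y) (λ u v → ∘-distribʳ u v i y) x

  tailSum-∘ʳ : ∀ (x : Op p) i (y : Fin k → Op n) j →
               x ∘[ i ] tailSum y j ≈ tailSum (λ a → x ∘[ i ] y a) j
  tailSum-∘ʳ {p = p} {n = n} x i = tailSum-hom {M = component n} {N = component (p + n)}
    (x ∘[ i ]_) (∘-zeroʳ x i) (∘-distribˡ x i)

  tailSum-∘-outerˡ : ∀ (x : Fin k → Op p) i (y : Fin l → Op n) j j′ →
                     tailSum (λ a → tailSum (λ b → x a ∘[ i ] y b) j′) j ≈ tailSum x j ∘[ i ] tailSum y j′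
  tailSum-∘-outerˡ x i y j j′ = ≈ᴹ-sym (≈ᴹ-trans (tailSum-∘ˡ x i (tailSum y j′) j)
    (tailSum-cong (λ a → tailSum-∘ʳ (x a) i y j′) j))

  tailSum-∘-outerʳ : ∀ (x : Fin k → Op p) i (y : Fin l → Op n) j j′ →
                     tailSum (λ b → tailSum (λ a → x a ∘[ i ] y b) j) j′ ≈ tailSum x j ∘[ i ] tailSum y j′
  tailSum-∘-outerʳ x i y j j′ = ≈ᴹ-sym (≈ᴹ-trans (tailSum-∘ʳ (tailSum x j) i y j′)
    (tailSum-cong (λ b → tailSum-∘ˡ x i (y b) j) j′))

  infix 4 _≅_
  _≅_ : Op p → Op q → Set ℓm
  _≅_ {p} {q} x y = Σ[ eq ∈ p ≡ q ] subst Op eq x ≈ y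

  ≈⇒≅ : {x y : Op n} → x ≈ y → x ≅ y
  ≈⇒≅ e = refl , e

  -- Equality proofs in ℕ are unique, so the arity proof inside `≅` may be exchanged for any other.
  ≅⇒≈ : {x : Op p} {y : Op q} → x ≅ y → ∀ eq → subst Op eq x ≈ y
  ≅⇒≈ (refl , e) eq rewrite ≡-irrelevant eq refl = e

  ≅-refl : {x : Op n} → x ≅ x
  ≅-refl = ≈⇒≅ ≈ᴹ-refl

  ≅-sym : {x : Op p} {y : Op q} → x ≅ y → y ≅ x
  ≅-sym (refl , e) = refl , ≈ᴹ-sym e

  ≅-trans : {x : Op p} {y : Op q} {z : Op n} → x ≅ y → y ≅ z → x ≅ z
  ≅-trans (refl , e) (refl , e′) = refl , ≈ᴹ-trans e e′

  ≅-subst : (eq : p ≡ q) (x : Op p) → subst Op eq x ≅ x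
  ≅-subst refl x = ≅-refl

  ∘-≅ : {x : Op p} {x′ : Op q} {y : Op k} {y′ : Op l} → x ≅ x′ →
        (i : Fin (suc p)) (i′ : Fin (suc q)) → toℕ i ≡ toℕ i′ → y ≅ y′ →
        x ∘[ i ] y ≅ x′ ∘[ i′ ] y′
  ∘-≅ (refl , e) i i′ h (refl , e′) with Fin.toℕ-injective h
  ... | refl = refl , ∘-cong i e e′

  sequential : ∀ (x : Op p) (y : Op q) (z : Op n) i j k → toℕ k ≡ toℕ i + toℕ j →
               (x ∘[ i ] y) ∘[ k ] z ≅ x ∘[ i ] (y ∘[ j ] z)
  sequential {p} {q} {n} x y z i j k h = eq , ∘-sequential x y z i j k h eq
    where
    eq : p + q + n ≡ p + (q + n)
    eq = +-assoc p q n

  parallel : ∀ (x : Op p) (y : Op q) (z : Op n) i j i′ j′ →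
             toℕ i < toℕ j → toℕ i′ ≡ toℕ i → toℕ j′ ≡ toℕ j + q →
             (x ∘[ i ] y) ∘[ j′ ] z ≅ (x ∘[ j ] z) ∘[ i′ ] y
  parallel {p} {q} {n} x y z i j i′ j′ i<j h h′ = eq , ∘-parallel x y z i j i′ j′ i<j h h′ eq
    where
    eq : p + q + n ≡ p + n + q
    eq = trans (+-assoc p q n) (trans (cong (p +_) (+-comm q n)) (sym (+-assoc p n q)))

  infix 8 _⦅_⋆_⦆
  -- The full composite g(x, y): once `x`, of arity `suc p`, fills input 0, the second input of `g`
  -- has number `suc p`. This is also the shape of `evalTree` at a node.
  _⦅_⋆_⦆ : Op 1 → Op p → Op q → Op (suc (p + q))
  _⦅_⋆_⦆ {p} g x y = (g ∘[ zero ] x) ∘[ fromℕ (suc p) ] y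

  ⦅⋆⦆-≅ : ∀ {x : Op p} {x′ : Op q} {y : Op k} {y′ : Op l} {g g′ : Op 1} → g ≈ g′ → x ≅ x′ → y ≅ y′ →
          g ⦅ x ⋆ y ⦆ ≅ g′ ⦅ x′ ⋆ y′ ⦆
  ⦅⋆⦆-≅ {p} {q} e h@(p≡q , _) h′ =
    ∘-≅ (∘-≅ (≈⇒≅ e) zero zero refl h) (fromℕ (suc p)) (fromℕ (suc q)) (cong (toℕ ∘ fromℕ ∘ suc) p≡q) h′

  ⦅⋆⦆-congˡ : ∀ {g g′ : Op 1} → g ≈ g′ → ∀ (x : Op p) (y : Op q) → g ⦅ x ⋆ y ⦆ ≈ g′ ⦅ x ⋆ y ⦆
  ⦅⋆⦆-congˡ {p} e x y = ∘-cong (fromℕ (suc p)) (∘-cong zero e (≈ᴹ-refl {x = x})) (≈ᴹ-refl {x = y})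

  private
    -- The composite t(x, y, z). Both nestings of two binary operations are brought to this form, so
    -- that a relation of arity 3 is applied to `t` alone.
    ternary : Op 2 → Op p → Op q → Op n → Op (2 + p + q + n)
    ternary {p} {q} t x y z =
      ((t ∘[ zero ] x) ∘[ Fin.inject₁ (fromℕ (suc p)) ] y) ∘[ fromℕ (2 + p + q) ] z

    ternary-left : ∀ (g h : Op 1) (x : Op p) (y : Op q) (z : Op n) →
                   g ⦅ h ⦅ x ⋆ y ⦆ ⋆ z ⦆ ≅ ternary (g ∘[ zero ] h) x y z
    ternary-left {p} {q} g h x y z = ∘-≅ (≅-trans
        (≅-sym (sequential g (h ∘[ zero ] x) y zero (fromℕ (suc p)) (Fin.inject₁ (fromℕ (suc p)))
          (Fin.toℕ-inject₁ (fromℕ (suc p)))))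
        (∘-≅ (≅-sym (sequential g h x zero zero zero refl)) _ _ refl ≅-refl))
      _ _ refl ≅-refl

    ternary-right : ∀ (g h : Op 1) (x : Op p) (y : Op q) (z : Op n) →
                    g ⦅ x ⋆ h ⦅ y ⋆ z ⦆ ⦆ ≅ ternary (g ∘[ suc zero ] h) x y z
    ternary-right {p} {q} {n} g h x y z = ≅-trans
      (≅-sym (sequential (g ∘[ zero ] x) (h ∘[ zero ] y) z (fromℕ (suc p)) (fromℕ (suc q))
        (fromℕ (suc p + suc q))
        (trans (Fin.toℕ-fromℕ (suc p + suc q)) (sym (cong₂ _+_ (Fin.toℕ-fromℕ (suc p)) (Fin.toℕ-fromℕ (suc q)))))))
      (∘-≅ (≅-trans
        (≅-sym (sequential (g ∘[ zero ] x) h y (fromℕ (suc p)) zero (fromℕ (suc p) Fin.↑ˡ 1)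
          (trans (Fin.toℕ-↑ˡ (fromℕ (suc p)) 1) (sym (+-identityʳ _)))))
        -- `x` and `h` fill different inputs of `g`, so `h` may be inserted first.
        (∘-≅ (parallel g x h zero (suc zero) zero (fromℕ (suc p)) (s≤s z≤n) refl (Fin.toℕ-fromℕ (suc p))) _ _
          (trans (Fin.toℕ-↑ˡ (fromℕ (suc p)) 1) (sym (Fin.toℕ-inject₁ (fromℕ (suc p))))) ≅-refl))
      _ _ (trans (Fin.toℕ-fromℕ (suc p + suc q))
             (trans (cong suc (+-suc p q)) (sym (Fin.toℕ-fromℕ (2 + p + q))))) ≅-refl)

  -- The form in which a quadratic relation is applied as a rewriting step, with arbitrary
  -- operations in place of the three inputs.
  nested : ∀ {g h g′ h′ : Op 1} → g ∘[ zero ] h ≈ g′ ∘[ suc zero ] h′ →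
           ∀ (x : Op p) (y : Op q) (z : Op n) → g ⦅ h ⦅ x ⋆ y ⦆ ⋆ z ⦆ ≅ g′ ⦅ x ⋆ h′ ⦅ y ⋆ z ⦆ ⦆
  nested {g = g} {h} {g′} {h′} e x y z = ≅-trans (ternary-left g h x y z) (≅-trans
    (∘-≅ (∘-≅ (∘-≅ (≈⇒≅ e) zero zero refl ≅-refl) _ _ refl ≅-refl) _ _ refl ≅-refl)
    (≅-sym (ternary-right g′ h′ x y z)))

-- Evaluation of trees in an operad

module Evaluation {R : CommutativeRing c ℓ} {G : Set} (O : Operad R m ℓm) (f : G → Operad.Op O 1) where
  open OperadProperties O
  private
    module F = Operad (Free R G)

    E : (t : BinTree G) → Op (nodes t)
    E = evalTree {R = R} O f

  -- For a leaf in the left subtree, the parallel axiom moves `s` past the right subtree; for one in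
  -- the right subtree, associativity is enough. The position occurs both as `i` and as `k` because
  -- grafting counts leaves in ℕ.
  evalTree-graft : ∀ t {k} (i : Fin (suc (nodes t))) → toℕ i ≡ k → ∀ s → E (graft t k s) ≅ E t ∘[ i ] E s
  evalTree-graft leaf zero h s = ≅-sym (≈⇒≅ (∘-identityˡ (E s)))
  evalTree-graft (node g l r) {k} i h s with k ≤? nodes l
  ... | yes k≤l = ≅-trans
    (∘-≅ (≅-trans
        (∘-≅ (≅-refl {x = f g}) zero zero refl (evalTree-graft l i′ toℕ-i′ s))
        (≅-sym (sequential (f g) (E l) (E s) zero i′ (Fin.inject₁ i′) (Fin.toℕ-inject₁ i′))))
      _ (fromℕ (suc (nodes l + nodes s))) (cong (toℕ ∘ fromℕ ∘ suc) (nodes-graft l k s)) ≅-refl)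
    (parallel (f g ∘[ zero ] E l) (E s) (E r) (Fin.inject₁ i′) (fromℕ (suc (nodes l))) i _
      i′<l
      (trans h (sym (trans (Fin.toℕ-inject₁ i′) toℕ-i′)))
      (trans (Fin.toℕ-fromℕ (suc (nodes l + nodes s)))
        (cong (_+ nodes s) (sym (Fin.toℕ-fromℕ (suc (nodes l)))))))
    where
    i′ : Fin (suc (nodes l))
    i′ = Fin.fromℕ< (s≤s k≤l)
    toℕ-i′ : toℕ i′ ≡ k
    toℕ-i′ = Fin.toℕ-fromℕ< (s≤s k≤l)
    i′<l : Fin.inject₁ i′ Fin.< fromℕ (suc (nodes l))
    i′<l = ≤-trans (s≤s (≤-reflexive (Fin.toℕ-inject₁ i′)))
      (≤-trans (Fin.toℕ<n i′) (≤-reflexive (sym (Fin.toℕ-fromℕ (suc (nodes l))))))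
  ... | no k≰l = ≅-trans
    (∘-≅ (≅-refl {x = f g ∘[ zero ] E l}) _ _ refl (evalTree-graft r i′ toℕ-i′ s))
    (≅-sym (sequential (f g ∘[ zero ] E l) (E r) (E s) (fromℕ (suc (nodes l))) i′ i
      (trans h (trans (sym (m+[n∸m]≡n (≰⇒> k≰l)))
        (sym (cong₂ _+_ (Fin.toℕ-fromℕ (suc (nodes l))) toℕ-i′))))))
    where
    k∸l≤r : k ∸ suc (nodes l) < suc (nodes r)
    k∸l≤r = s≤s (≤-trans (∸-monoˡ-≤ (suc (nodes l)) (≤-trans (≤-reflexive (sym h)) (Fin.toℕ≤pred[n] i)))
      (≤-reflexive (m+n∸m≡n (suc (nodes l)) (nodes r))))
    i′ : Fin (suc (nodes r))
    i′ = Fin.fromℕ< k∸l≤r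
    toℕ-i′ : toℕ i′ ≡ k ∸ suc (nodes l)
    toℕ-i′ = Fin.toℕ-fromℕ< k∸l≤r

  ev : ∀ {n} → F.Op n → Op n
  ev = eval O f

  ev-cong : ∀ {n} {x y : F.Op n} → x F.≈ y → ev x ≈ ev y
  ev-cong {n} = linearExtension-cong R (component n) _

  ev-∘ : ∀ {p q} (x : F.Op p) i (y : F.Op q) → ev (x F.∘[ i ] y) ≈ ev x ∘[ i ] ev y
  ev-∘ 𝟎        i y = ≈ᴹ-sym (∘-zeroˡ i (ev y))
  ev-∘ (x ⊞ x′) i y = ≈ᴹ-trans (+ᴹ-cong (ev-∘ x i y) (ev-∘ x′ i y)) (≈ᴹ-sym (∘-distribʳ _ _ i _))
  ev-∘ (k ⊡ x)  i y = ≈ᴹ-trans (*ₗ-cong (CommutativeRing.refl R) (ev-∘ x i y)) (≈ᴹ-sym (∘-scaleˡ k _ i _))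
  ev-∘ [ t ] i 𝟎        = ≈ᴹ-sym (∘-zeroʳ (ev [ t ]) i)
  ev-∘ [ t ] i (y ⊞ y′) =
    ≈ᴹ-trans (+ᴹ-cong (ev-∘ [ t ] i y) (ev-∘ [ t ] i y′)) (≈ᴹ-sym (∘-distribˡ _ i _ _))
  ev-∘ [ t ] i (k ⊡ y)  =
    ≈ᴹ-trans (*ₗ-cong (CommutativeRing.refl R) (ev-∘ [ t ] i y)) (≈ᴹ-sym (∘-scaleʳ k _ i _))
  ev-∘ [ t , refl ] i [ s , refl ] = ≅⇒≈ (evalTree-graft t i refl s) _

  ev-generator : ∀ g → ev (generator R g) ≈ f g
  ev-generator g = ≈ᴹ-trans (∘-identityʳ _ (suc zero) refl) (∘-identityʳ (f g) zero refl)

-- Given and monomial relations in an arbitrary operad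

module Relations {R : CommutativeRing c ℓ} (O : Operad R m ℓm) {γ} (g : 𝔊′ γ → Operad.Op O 1) where
  open OperadProperties O

  Tail⊣ Tail⊢ : ℕ → Op 1
  Tail⊣ = tailSum (λ a → g (⊣′ a))
  Tail⊢ = tailSum (λ a → g (⊢′ a))

  -- The thirteen families of `ℜ′` as equations: the null, two-term and sum families are the three
  -- fields of the four triangular systems, and the family without order condition stands alone.
  record PrimedRelations : Set ℓm where
    field
      ⊢∘₁⊢ : Triangular (λ c d → g (⊢′ c) ∘[ zero ] g (⊢′ d)) (λ x y → g (⊢′ x) ∘[ suc zero ] g (⊢′ y))
      ⊢∘₁⊣ : Triangular (λ c d → g (⊢′ c) ∘[ zero ] g (⊣′ d)) (λ x y → g (⊢′ y) ∘[ suc zero ] g (⊢′ x))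
      ⊣∘₂⊣ : Triangular (λ c d → g (⊣′ c) ∘[ suc zero ] g (⊣′ d)) (λ x y → g (⊣′ x) ∘[ zero ] g (⊣′ y))
      ⊣∘₂⊢ : Triangular (λ c d → g (⊣′ c) ∘[ suc zero ] g (⊢′ d)) (λ x y → g (⊣′ y) ∘[ zero ] g (⊣′ x))
      ⊣∘₁⊢ : ∀ a b → g (⊣′ a) ∘[ zero ] g (⊢′ b) ≈ g (⊢′ b) ∘[ suc zero ] g (⊣′ a)

  -- The relations of the monomial presentation of Dias.
  record UnprimedRelations : Set ℓm where
    field
      ⊢∘₁⊢ : ∀ (b a : Fin γ) → Tail⊢ (toℕ b) ∘[ zero ] Tail⊢ (toℕ a) ≈
                               Tail⊢ (toℕ a ⊔ toℕ b) ∘[ suc zero ] Tail⊢ (toℕ b)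
      ⊢∘₁⊣ : ∀ (b a : Fin γ) → Tail⊢ (toℕ b) ∘[ zero ] Tail⊣ (toℕ a) ≈
                               Tail⊢ (toℕ b) ∘[ suc zero ] Tail⊢ (toℕ a ⊔ toℕ b)
      ⊣∘₂⊣ : ∀ (b a : Fin γ) → Tail⊣ (toℕ b) ∘[ suc zero ] Tail⊣ (toℕ a) ≈
                               Tail⊣ (toℕ a ⊔ toℕ b) ∘[ zero ] Tail⊣ (toℕ b)
      ⊣∘₂⊢ : ∀ (b a : Fin γ) → Tail⊣ (toℕ b) ∘[ suc zero ] Tail⊢ (toℕ a) ≈
                               Tail⊣ (toℕ b) ∘[ zero ] Tail⊣ (toℕ a ⊔ toℕ b)
      ⊣∘₁⊢ : ∀ (a b : Fin γ) → Tail⊣ (toℕ a) ∘[ zero ] Tail⊢ (toℕ b) ≈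
                               Tail⊢ (toℕ b) ∘[ suc zero ] Tail⊣ (toℕ a)

  private
    module _ {x y u v : Fin γ → Op 1} {i i′ : Fin 2} where
      P T T′ : Fin γ → Fin γ → Op 2
      P  c d = x c ∘[ i ] y d
      T  e f = u e ∘[ i′ ] v f
      T′ e f = v f ∘[ i′ ] u e

      to-tails : Triangular P T → ∀ (b a : Fin γ) →
                 tailSum x (toℕ b) ∘[ i ] tailSum y (toℕ a) ≈
                 tailSum u (toℕ a ⊔ toℕ b) ∘[ i′ ] tailSum v (toℕ b)
      to-tails t b a = ≈ᴹ-trans (≈ᴹ-sym (tailSum-∘-outerʳ x i y (toℕ b) (toℕ a)))
        (≈ᴹ-trans (triangular⇒maxRule t (toℕ b) (toℕ a)) (tailSum-∘-outerˡ u i′ v (toℕ a ⊔ toℕ b) (toℕ b)))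

      -- Unlike in `to-tails`, the label that becomes the maximum sits in the inner factor.
      to-tails′ : Triangular P T′ → ∀ (b a : Fin γ) →
                  tailSum x (toℕ b) ∘[ i ] tailSum y (toℕ a) ≈
                  tailSum v (toℕ b) ∘[ i′ ] tailSum u (toℕ a ⊔ toℕ b)
      to-tails′ t b a = ≈ᴹ-trans (≈ᴹ-sym (tailSum-∘-outerʳ x i y (toℕ b) (toℕ a)))
        (≈ᴹ-trans (triangular⇒maxRule t (toℕ b) (toℕ a)) (tailSum-∘-outerʳ v i′ u (toℕ b) (toℕ a ⊔ toℕ b)))

      from-tails : (∀ (b a : Fin γ) → tailSum x (toℕ b) ∘[ i ] tailSum y (toℕ a) ≈
                                      tailSum u (toℕ a ⊔ toℕ b) ∘[ i′ ] tailSum v (toℕ b)) →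
                   Triangular P T
      from-tails h = maxRule⇒triangular (maxRule-extend λ b a →
        ≈ᴹ-trans (tailSum-∘-outerʳ x i y (toℕ b) (toℕ a))
          (≈ᴹ-trans (h b a) (≈ᴹ-sym (tailSum-∘-outerˡ u i′ v (toℕ a ⊔ toℕ b) (toℕ b)))))

      from-tails′ : (∀ (b a : Fin γ) → tailSum x (toℕ b) ∘[ i ] tailSum y (toℕ a) ≈
                                       tailSum v (toℕ b) ∘[ i′ ] tailSum u (toℕ a ⊔ toℕ b)) →
                    Triangular P T′
      from-tails′ h = maxRule⇒triangular (maxRule-extend λ b a →
        ≈ᴹ-trans (tailSum-∘-outerʳ x i y (toℕ b) (toℕ a))
          (≈ᴹ-trans (h b a) (≈ᴹ-sym (tailSum-∘-outerʳ v i′ u (toℕ b) (toℕ a ⊔ toℕ b)))))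

    tailSum-≥-ext : ∀ {x y : Fin γ → Op 2} → (∀ (a : Fin γ) → tailSum x (toℕ a) ≈ tailSum y (toℕ a)) →
                    ∀ k → tailSum x k ≈ tailSum y k
    tailSum-≥-ext {x} {y} h k with toℕ-view γ k
    ... | inj₁ (a , refl) = h a
    ... | inj₂ γ≤k        = ≈ᴹ-trans (tailSum-≥ x γ≤k) (≈ᴹ-sym (tailSum-≥ y γ≤k))

  primed⇒unprimed : PrimedRelations → UnprimedRelations
  primed⇒unprimed r = record
    { ⊢∘₁⊢ = to-tails ⊢∘₁⊢
    ; ⊢∘₁⊣ = to-tails′ ⊢∘₁⊣
    ; ⊣∘₂⊣ = to-tails ⊣∘₂⊣
    ; ⊣∘₂⊢ = to-tails′ ⊣∘₂⊢
    ; ⊣∘₁⊢ = λ a b → ≈ᴹ-trans (≈ᴹ-sym (tailSum-∘-outerˡ (g ∘ ⊣′) zero (g ∘ ⊢′) (toℕ a) (toℕ b)))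
        (≈ᴹ-trans (tailSum-cong (λ c →
            tailSum-cong {y = λ b → g (⊢′ b) ∘[ suc zero ] g (⊣′ c)} (⊣∘₁⊢ c) (toℕ b)) (toℕ a))
                  (tailSum-∘-outerʳ (g ∘ ⊢′) (suc zero) (g ∘ ⊣′) (toℕ b) (toℕ a)))
    }
    where open PrimedRelations r

  unprimed⇒primed : UnprimedRelations → PrimedRelations
  unprimed⇒primed r = record
    { ⊢∘₁⊢ = from-tails ⊢∘₁⊢
    ; ⊢∘₁⊣ = from-tails′ ⊢∘₁⊣
    ; ⊣∘₂⊣ = from-tails ⊣∘₂⊣
    ; ⊣∘₂⊢ = from-tails′ ⊣∘₂⊢
    -- No max occurs here: one difference in each of the two labels isolates the term.
    ; ⊣∘₁⊢ = λ a → tailSum-injective (tailSum-≥-ext λ b →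
        tailSum-injective (tailSum-≥-ext λ a →
          ≈ᴹ-trans (tailSum-∘-outerˡ (g ∘ ⊣′) zero (g ∘ ⊢′) (toℕ a) (toℕ b))
            (≈ᴹ-trans (⊣∘₁⊢ a b) (≈ᴹ-sym (tailSum-∘-outerʳ (g ∘ ⊢′) (suc zero) (g ∘ ⊣′) (toℕ b) (toℕ a))))) a)
    }
    where open UnprimedRelations r

-- Products by generators on words

module _ {γ : ℕ} where
  word-≡ : ∀ {n} {u v : Word γ n} → proj₁ u ≡ proj₁ v → u ≡ v
  word-≡ = Σ-prop-≡ λ (p , q) (p′ , q′) → cong₂ _,_ (≡-irrelevant p p′) (≡-irrelevant q q′)

  private
    module MaxL = Max (Fin.≤-totalOrder (suc γ))

  toℕ-⊔ᴸ : ∀ (x y : Letter γ) → toℕ (x ⊔ᴸ y) ≡ toℕ y ⊔ toℕ x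
  toℕ-⊔ᴸ x y with ≤-total (toℕ x) (toℕ y)
  ... | inj₁ x≤y = trans (cong toℕ (MaxL.x≤y⇒x⊔y≈y {y} {x} x≤y)) (sym (m≥n⇒m⊔n≡m x≤y))
  ... | inj₂ y≤x = trans (cong toℕ (MaxL.x≤y⇒y⊔x≈y {x} {y} y≤x))
                    (sym (m≤n⇒m⊔n≡n y≤x))

  -- Matching on this exposes the max of two nonzero letters as a successor, on which `normalForm`
  -- and `appendLetters` compute.
  suc-⊔ᴸ-suc : ∀ (a b : Fin γ) → Σ[ d ∈ Fin γ ] suc a ⊔ᴸ suc b ≡ suc d × toℕ d ≡ toℕ b ⊔ toℕ a
  suc-⊔ᴸ-suc a b with suc a ⊔ᴸ suc b | toℕ-⊔ᴸ (suc a) (suc b)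
  ... | zero  | ()
  ... | suc d | e = d , refl , suc-injective e

  zero-⊔ᴸ : ∀ (x : Letter γ) → zero ⊔ᴸ x ≡ x
  zero-⊔ᴸ x = MaxL.x≤y⇒x⊔y≈y {x} {zero} z≤n

  ⊔ᴸ-zero : ∀ (x : Letter γ) → x ⊔ᴸ zero ≡ x
  ⊔ᴸ-zero x = trans (MaxL.⊔-comm x zero) (zero-⊔ᴸ x)

  map-zero-⊔ᴸ : ∀ (u : List (Letter γ)) → map (zero ⊔ᴸ_) u ≡ u
  map-zero-⊔ᴸ []      = refl
  map-zero-⊔ᴸ (x ∷ u) = cong₂ _∷_ (zero-⊔ᴸ x) (map-zero-⊔ᴸ u)

  insert-length : ∀ (u v w : List (Letter γ)) → insert (u ++ v) (length u) w ≡ u ++ insert v 0 w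
  insert-length []      v w = refl
  insert-length (x ∷ u) v w = cong (x ∷_) (insert-length u v w)

  infixl 6 _⋆[_]_
  -- The composite of a generator with two words, free of positions: the word inserted at the letter
  -- 0 is unchanged, the one inserted at `a` is raised to at least `a`.
  _⋆[_]_ : List (Letter γ) → 𝔊 γ → List (Letter γ) → List (Letter γ)
  u ⋆[ ⊣ a ] v = u ++ map (suc a ⊔ᴸ_) v
  u ⋆[ ⊢ a ] v = map (suc a ⊔ᴸ_) u ++ v

  insert-word : ∀ g (u v : List (Letter γ)) →
                insert (insert (proj₁ (word g)) 0 u) (length u) v ≡ u ⋆[ g ] v
  insert-word (⊣ a) u v = begin
    insert (map (zero ⊔ᴸ_) u ++ suc a ∷ []) (length u) v
      ≡⟨ cong (λ t → insert (t ++ suc a ∷ []) (length u) v) (map-zero-⊔ᴸ u) ⟩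
    insert (u ++ suc a ∷ []) (length u) v   ≡⟨ insert-length u _ v ⟩
    u ++ (map (suc a ⊔ᴸ_) v ++ [])          ≡⟨ cong (u ++_) (++-identityʳ _) ⟩
    u ++ map (suc a ⊔ᴸ_) v                  ∎
    where open ≡-Reasoning
  insert-word (⊢ a) u v = begin
    insert (map (suc a ⊔ᴸ_) u ++ zero ∷ []) (length u) v
      ≡⟨ cong (λ k → insert (map (suc a ⊔ᴸ_) u ++ zero ∷ []) k v) (length-map _ u) ⟨
    insert (map (suc a ⊔ᴸ_) u ++ zero ∷ []) (length (map (suc a ⊔ᴸ_) u)) v
      ≡⟨ insert-length (map (suc a ⊔ᴸ_) u) _ v ⟩
    map (suc a ⊔ᴸ_) u ++ insert (zero ∷ []) 0 v   ≡⟨ cong (map (suc a ⊔ᴸ_) u ++_) (insert-identityˡ v) ⟩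
    map (suc a ⊔ᴸ_) u ++ v                        ∎
    where open ≡-Reasoning

-- Normal forms in an operad that satisfies the monomial relations

module NormalForms {R : CommutativeRing c ℓ} (O : Operad R m ℓm) {γ} (g : 𝔊′ γ → Operad.Op O 1)
                   (rel : Relations.UnprimedRelations O g) where
  open OperadProperties O
  open Relations O g
  open UnprimedRelations rel
  private
    module D = OperadProperties (Dias R γ)

  unprimed : 𝔊 γ → Op 1
  unprimed (⊣ a) = Tail⊣ (toℕ a)
  unprimed (⊢ a) = Tail⊢ (toℕ a)

  -- Bundling the arity lets normal forms be defined by recursion on bare lists; the arity is
  -- matched with the length only in `normalFormᵂ`.
  Element : Set m
  Element = Σ ℕ Op

  infix 4 _∼_
  _∼_ : Element → Element → Set ℓm
  x ∼ y = proj₂ x ≅ proj₂ y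

  unit : Element
  unit = 0 , id

  product : Op 1 → Element → Element → Element
  product f (p , x) (q , y) = suc (p + q) , f ⦅ x ⋆ y ⦆

  product-cong : ∀ {f f′ x x′ y y′} → f ≈ f′ → x ∼ x′ → y ∼ y′ → product f x y ∼ product f′ x′ y′
  product-cong = ⦅⋆⦆-≅

  nested′ : ∀ {f h f′ h′} → f ∘[ zero ] h ≈ f′ ∘[ suc zero ] h′ →
            ∀ x y z → product f (product h x y) z ∼ product f′ x (product h′ y z)
  nested′ e (_ , x) (_ , y) (_ , z) = nested e x y z

  -- A second letter 0 is skipped; no word of Dias has one.
  appendLetters : Element → List (Letter γ) → Element
  appendLetters x []          = x
  appendLetters x (zero ∷ w)  = appendLetters x w
  appendLetters x (suc b ∷ w) = appendLetters (product (unprimed (⊣ b)) x unit) w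

  -- Each `unit` in the comb stands for the word 0, which a max with a letter turns into that
  -- letter. The value at `[]` is a default: a word of Dias contains a 0.
  normalForm : List (Letter γ) → Element
  normalForm []          = unit
  normalForm (zero ∷ w)  = appendLetters unit w
  normalForm (suc a ∷ w) = product (unprimed (⊢ a)) unit (normalForm w)

  appendLetters-cong : ∀ {x y} w → x ∼ y → appendLetters x w ∼ appendLetters y w
  appendLetters-cong []          e = e
  appendLetters-cong (zero ∷ w)  e = appendLetters-cong w e
  appendLetters-cong (suc b ∷ w) e = appendLetters-cong w (product-cong ≈ᴹ-refl e ≅-refl)

  appendLetters-++ : ∀ x v w → appendLetters (appendLetters x v) w ≡ appendLetters x (v ++ w)
  appendLetters-++ x []          w = refl
  appendLetters-++ x (zero ∷ v)  w = appendLetters-++ x v w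
  appendLetters-++ x (suc b ∷ v) w = appendLetters-++ _ v w

  arity-appendLetters : ∀ x w → zeros w ≡ 0 → proj₁ (appendLetters x w) ≡ proj₁ x + length w
  arity-appendLetters x []          e = sym (+-identityʳ _)
  arity-appendLetters x (suc b ∷ w) e = trans (arity-appendLetters _ w e)
    (trans (cong (λ k → suc k + length w) (+-identityʳ (proj₁ x))) (sym (+-suc (proj₁ x) (length w))))

  arity-normalForm : ∀ w → zeros w ≡ 1 → suc (proj₁ (normalForm w)) ≡ length w
  arity-normalForm (zero ∷ w)  e = cong suc (arity-appendLetters unit w (suc-injective e))
  arity-normalForm (suc a ∷ w) e = cong suc (arity-normalForm w e)

  private
    ∼-reflexive : ∀ {x y} → x ≡ y → x ∼ y
    ∼-reflexive refl = ≅-refl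

    module _ (a : Fin γ) where

      -- Rewriting step: (x ⊣_b 1) ⊢_a z = x ⊢_a (1 ⊢_max(a,b) z). Since `appendLetters`
      -- accumulates, the induction hypothesis comes first, and the last letter of `u` is moved
      -- before the others.
      ⊢-appendLetters : ∀ x u v → zeros u ≡ 0 →
        product (unprimed (⊢ a)) (appendLetters x u) (normalForm v) ∼
        product (unprimed (⊢ a)) x (normalForm (map (suc a ⊔ᴸ_) u ++ v))
      ⊢-appendLetters x []          v e = ≅-refl
      ⊢-appendLetters x (suc b ∷ u) v e with suc a ⊔ᴸ suc b | suc-⊔ᴸ-suc a b
      ... | _ | d , refl , d≡ = ≅-trans (⊢-appendLetters _ u v e) (≅-trans
        (nested′ (⊢∘₁⊣ a b) x unit _)
        (product-cong ≈ᴹ-refl ≅-refl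
          (product-cong (≈ᴹ-reflexive (cong Tail⊢ (sym d≡))) ≅-refl ≅-refl)))

      ⊢-normalForm : ∀ u v → zeros u ≡ 1 →
        product (unprimed (⊢ a)) (normalForm u) (normalForm v) ∼ normalForm (map (suc a ⊔ᴸ_) u ++ v)
      -- The 0 of `u` becomes the letter `a` and supplies the outermost product.
      ⊢-normalForm (zero ∷ u) v e rewrite ⊔ᴸ-zero {γ} (suc a) =
        ⊢-appendLetters unit u v (suc-injective e)
      ⊢-normalForm (suc b ∷ u) v e with suc a ⊔ᴸ suc b | suc-⊔ᴸ-suc a b
      ... | _ | d , refl , d≡ = ≅-trans (nested′ (⊢∘₁⊢ a b) unit _ _)
        (product-cong (≈ᴹ-reflexive (cong Tail⊢ (sym d≡))) ≅-refl (⊢-normalForm u v e))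

      -- Rewriting step: x ⊣_a (y ⊣_b 1) = (x ⊣_a y) ⊣_max(a,b) 1.
      ⊣-appendLetters : ∀ x y v → zeros v ≡ 0 →
        product (unprimed (⊣ a)) x (appendLetters y v) ∼
        appendLetters (product (unprimed (⊣ a)) x y) (map (suc a ⊔ᴸ_) v)
      ⊣-appendLetters x y []          e = ≅-refl
      ⊣-appendLetters x y (suc b ∷ v) e with suc a ⊔ᴸ suc b | suc-⊔ᴸ-suc a b
      ... | _ | d , refl , d≡ = ≅-trans (⊣-appendLetters x _ v e)
        (appendLetters-cong (map (suc a ⊔ᴸ_) v) (≅-trans
          (≅-sym (nested′ (≈ᴹ-sym (⊣∘₂⊣ a b)) x y unit))
          (product-cong (≈ᴹ-reflexive (cong Tail⊣ (sym d≡))) ≅-refl ≅-refl)))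

      -- Rewriting step: x ⊣_a (1 ⊢_b z) = (x ⊣_max(a,b) 1) ⊣_a z, which turns the letters before
      -- the 0 of `v` into appended ones. The 0 itself becomes `a`.
      ⊣-appends : ∀ x v → zeros v ≡ 1 →
        product (unprimed (⊣ a)) x (normalForm v) ∼ appendLetters x (map (suc a ⊔ᴸ_) v)
      ⊣-appends x (zero ∷ v) e rewrite ⊔ᴸ-zero {γ} (suc a) = ⊣-appendLetters x unit v (suc-injective e)
      ⊣-appends x (suc b ∷ v) e with suc a ⊔ᴸ suc b | suc-⊔ᴸ-suc a b
      ... | _ | d , refl , d≡ = ≅-trans (≅-sym (nested′ (≈ᴹ-sym (⊣∘₂⊢ a b)) x unit (normalForm v)))
        (≅-trans (⊣-appends _ v e)
          (appendLetters-cong (map (suc a ⊔ᴸ_) v)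
            (product-cong (≈ᴹ-reflexive (cong Tail⊣ (sym d≡))) ≅-refl ≅-refl)))

      ⊣-normalForm : ∀ u v → zeros u ≡ 1 → zeros v ≡ 1 →
        product (unprimed (⊣ a)) (normalForm u) (normalForm v) ∼ normalForm (u ++ map (suc a ⊔ᴸ_) v)
      ⊣-normalForm (zero ∷ u) v e e′ = ≅-trans (⊣-appends _ v e′)
        (∼-reflexive (appendLetters-++ unit u (map (suc a ⊔ᴸ_) v)))
      ⊣-normalForm (suc b ∷ u) v e e′ = ≅-trans (nested′ (⊣∘₁⊢ a b) unit (normalForm u) (normalForm v))
        (product-cong ≈ᴹ-refl ≅-refl (⊣-normalForm u v e e′))

  normalForm-⋆ : ∀ f u v → zeros u ≡ 1 → zeros v ≡ 1 →
                 normalForm (u ⋆[ f ] v) ∼ product (unprimed f) (normalForm u) (normalForm v)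
  normalForm-⋆ (⊣ a) u v e e′ = ≅-sym (⊣-normalForm a u v e e′)
  normalForm-⋆ (⊢ a) u v e e′ = ≅-sym (⊢-normalForm a u v e)

  normalFormᵂ : ∀ {n} → Word γ n → Op n
  normalFormᵂ (w , p , q) = subst Op (suc-injective (trans (arity-normalForm w q) p)) (proj₂ (normalForm w))

  normalize : ∀ {n} → D.Op n → Op n
  normalize {n} = linearExtension R (component n) normalFormᵂ

  normalFormᵂ-≅ : ∀ {n} (w : Word γ n) → normalFormᵂ w ≅ proj₂ (normalForm (proj₁ w))
  normalFormᵂ-≅ (w , p , q) = ≅-subst _ (proj₂ (normalForm w))

  -- The condition is linear in the pair (`e`, `e′`). It can thus be checked on the unprimed
  -- generators, whose products send words to words, and carried over to their differences.
  record Transports (e : D.Op 1) (e′ : Op 1) : Set (c ⊔ˡ m ⊔ˡ ℓm) where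
    constructor transports
    field
      transport : ∀ {p q} (x : D.Op p) (y : D.Op q) →
                  normalize (e D.⦅ x ⋆ y ⦆) ≈ e′ ⦅ normalize x ⋆ normalize y ⦆
  open Transports public

  transports-word : ∀ f → Transports [ word f ] (unprimed f)
  transports-word f = transports multilinear
    where
    module R = CommutativeRing R
    module W = SetOperad (wordOperad γ)
    h : Op 1
    h = unprimed f
    on-words : ∀ {p q} (u : Word γ p) (v : Word γ q) →
               normalize ([ word f ] D.⦅ [ u ] ⋆ [ v ] ⦆) ≈ h ⦅ normalize [ u ] ⋆ normalize [ v ] ⦆
    on-words {p} U@(u , eu , zu) V@(v , ev , zv) = ≅⇒≈ (≅-trans
      (normalFormᵂ-≅ ((word f W.∘[ zero ] U) W.∘[ fromℕ (suc p) ] V)) (≅-trans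
      (∼-reflexive (cong normalForm (trans
        (cong (λ k → insert (insert (proj₁ (word f)) 0 u) k v) (trans (Fin.toℕ-fromℕ (suc p)) (sym eu)))
        (insert-word f u v))))
      (≅-trans (normalForm-⋆ f u v zu zv)
        (⦅⋆⦆-≅ ≈ᴹ-refl (≅-sym (normalFormᵂ-≅ U)) (≅-sym (normalFormᵂ-≅ V)))))) refl
    multilinear : ∀ {p q} (x : D.Op p) (y : D.Op q) →
                  normalize ([ word f ] D.⦅ x ⋆ y ⦆) ≈ h ⦅ normalize x ⋆ normalize y ⦆
    multilinear 𝟎 y = ≈ᴹ-sym (≈ᴹ-trans (∘-cong _ (∘-zeroʳ h zero) ≈ᴹ-refl) (∘-zeroˡ _ (normalize y)))
    multilinear (x ⊞ x′) y = ≈ᴹ-trans (+ᴹ-cong (multilinear x y) (multilinear x′ y))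
      (≈ᴹ-sym (≈ᴹ-trans (∘-cong _ (∘-distribˡ h zero _ _) ≈ᴹ-refl) (∘-distribʳ _ _ _ _)))
    multilinear (k ⊡ x) y = ≈ᴹ-trans (*ₗ-cong R.refl (multilinear x y))
      (≈ᴹ-sym (≈ᴹ-trans (∘-cong _ (∘-scaleʳ k h zero _) ≈ᴹ-refl) (∘-scaleˡ k _ _ _)))
    multilinear [ u ] 𝟎 = ≈ᴹ-sym (∘-zeroʳ _ _)
    multilinear [ u ] (y ⊞ y′) = ≈ᴹ-trans (+ᴹ-cong (multilinear [ u ] y) (multilinear [ u ] y′))
      (≈ᴹ-sym (∘-distribˡ _ _ _ _))
    multilinear [ u ] (k ⊡ y) = ≈ᴹ-trans (*ₗ-cong R.refl (multilinear [ u ] y)) (≈ᴹ-sym (∘-scaleʳ k _ _ _))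
    multilinear [ u ] [ v ] = on-words u v

  normalize-cong : ∀ {n} {x y : D.Op n} → x D.≈ y → normalize x ≈ normalize y
  normalize-cong {n} = linearExtension-cong R (component n) normalFormᵂ

  transports-cong : ∀ {e e₁ e′ e₁′} → e D.≈ e₁ → e′ ≈ e₁′ → Transports e e′ → Transports e₁ e₁′
  transports-cong h h′ t = transports λ x y → ≈ᴹ-trans
    (normalize-cong (D.⦅⋆⦆-congˡ (D.≈ᴹ-sym h) x y))
    (≈ᴹ-trans (transport t x y) (⦅⋆⦆-congˡ h′ _ _))

  transports-𝟘 : Transports D.𝟘 𝟘
  transports-𝟘 = transports λ x y → ≈ᴹ-sym (≈ᴹ-trans (∘-cong _ (∘-zeroˡ zero _) ≈ᴹ-refl) (∘-zeroˡ _ _))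

  transports-cancel : ∀ {e e₁ e′ e₁′} → Transports (e D.⊕ e₁) (e′ ⊕ e₁′) → Transports e₁ e₁′ → Transports e e′
  transports-cancel t t₁ = transports λ {p} {q} x y →
    let open AbelianGroupProperties (Comp.+ᴹ-abelianGroup {suc (p + q)}) using (∙-cancelʳ) in
    ∙-cancelʳ _ _ _ (≈ᴹ-trans (transport t x y)
      (≈ᴹ-trans (∘-cong _ (∘-distribʳ _ _ zero _) ≈ᴹ-refl)
      (≈ᴹ-trans (∘-distribʳ _ _ _ _) (+ᴹ-cong ≈ᴹ-refl (≈ᴹ-sym (transport t₁ x y))))))

  -- Each `e a` is the difference of two consecutive tails; beyond the last label both tails are
  -- zero.
  transports-differences : ∀ (e : Fin γ → D.Op 1) (e′ : Fin γ → Op 1) →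
    (∀ a → Transports (D.tailSum e (toℕ a)) (tailSum e′ (toℕ a))) → ∀ a → Transports (e a) (e′ a)
  transports-differences e e′ t a = transports-cancel
    (transports-cong (D.tailSum-step e a) (tailSum-step e′ a) (t a)) (tails (suc (toℕ a)))
    where
    tails : ∀ k → Transports (D.tailSum e k) (tailSum e′ k)
    tails k with toℕ-view γ k
    ... | inj₁ (a , refl) = t a
    ... | inj₂ γ≤k        =
      transports-cong (D.≈ᴹ-sym (D.tailSum-≥ e γ≤k)) (≈ᴹ-sym (tailSum-≥ e′ γ≤k)) transports-𝟘

  transports-letters : ∀ (f : 𝔊′ γ → D.Op 1) →
    (∀ a → D.tailSum (f ∘ ⊣′) (toℕ a) D.≈ [ word (⊣ a) ]) →
    (∀ a → D.tailSum (f ∘ ⊢′) (toℕ a) D.≈ [ word (⊢ a) ]) → ∀ g′ → Transports (f g′) (g g′)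
  transports-letters f h⊣ h⊢ (⊣′ a) = transports-differences (f ∘ ⊣′) (g ∘ ⊣′)
    (λ b → transports-cong (D.≈ᴹ-sym (h⊣ b)) ≈ᴹ-refl (transports-word (⊣ b))) a
  transports-letters f h⊣ h⊢ (⊢′ a) = transports-differences (f ∘ ⊢′) (g ∘ ⊢′)
    (λ b → transports-cong (D.≈ᴹ-sym (h⊢ b)) ≈ᴹ-refl (transports-word (⊢ b))) a

  normalize-product : ∀ {p q e e′} → Transports e e′ → ∀ (x : D.Op p) (y : D.Op q) {x′ y′} →
                      normalize x ≈ x′ → normalize y ≈ y′ → normalize (e D.⦅ x ⋆ y ⦆) ≈ e′ ⦅ x′ ⋆ y′ ⦆
  normalize-product {p} t x y h h′ =
    ≈ᴹ-trans (transport t x y) (∘-cong (fromℕ (suc p)) (∘-cong zero ≈ᴹ-refl h) h′)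

  normalize-separates : ∀ {n} {x y : D.Op n} {x′ y′ : Op n} → normalize x ≈ x′ → normalize y ≈ y′ →
                        x D.≈ y → x′ ≈ y′
  normalize-separates h h′ e = ≈ᴹ-trans (≈ᴹ-sym h) (≈ᴹ-trans (normalize-cong e) h′)

  module _ (e : ∀ {n} → Op n → D.Op n)
           (e-∘ : ∀ {p q} (x : Op p) i (y : Op q) → e (x ∘[ i ] y) D.≈ e x D.∘[ i ] e y)
           (e-id : e id D.≈ D.id)
           (e-𝟘 : ∀ {n} → e (𝟘 {n}) D.≈ D.𝟘)
           (e-⊕ : ∀ {n} (x y : Op n) → e (x ⊕ y) D.≈ e x D.⊕ e y)
           (e-· : ∀ {n} k (x : Op n) → e (k · x) D.≈ k D.· e x)
           (e-unprimed : ∀ f → e (unprimed f) D.≈ [ word f ]) where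
    private
      module W = SetOperad (wordOperad γ)

      -- The length and zero-count proofs travel inside `value`, so that along the recursion only
      -- lists need to be compared.
      record EvaluatesTo (x : Element) (w : List (Letter γ)) : Set (c ⊔ˡ ℓ) where
        field
          value   : Word γ (proj₁ x)
          letters : proj₁ value ≡ w
          equal   : e (proj₂ x) D.≈ [ value ]
      open EvaluatesTo

      product-evaluates : ∀ f {x y u v} → EvaluatesTo x u → EvaluatesTo y v →
                          EvaluatesTo (product (unprimed f) x y) (u ⋆[ f ] v)
      product-evaluates f {p , x} {q , y} h h′ = record
        { value   = (word f W.∘[ zero ] value h) W.∘[ fromℕ (suc p) ] value h′
        ; letters = trans
            (cong (λ k → insert (insert (proj₁ (word f)) 0 (proj₁ (value h))) k (proj₁ (value h′)))
              (trans (Fin.toℕ-fromℕ (suc p)) (sym (proj₁ (proj₂ (value h))))))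
            (trans (insert-word f (proj₁ (value h)) (proj₁ (value h′)))
              (cong₂ (λ u v → u ⋆[ f ] v) (letters h) (letters h′)))
        ; equal   = D.≈ᴹ-trans (e-∘ (unprimed f ∘[ zero ] x) (fromℕ (suc p)) y)
            (D.∘-cong (fromℕ (suc p))
              (D.≈ᴹ-trans (e-∘ (unprimed f) zero x) (D.∘-cong zero (e-unprimed f) (equal h))) (equal h′))
        }

      unit-evaluates : EvaluatesTo unit (zero ∷ [])
      unit-evaluates = record { value = W.id ; letters = refl ; equal = e-id }

      appendLetters-evaluates : ∀ {x u} w → zeros w ≡ 0 → EvaluatesTo x u →
                                EvaluatesTo (appendLetters x w) (u ++ w)
      appendLetters-evaluates {x} {u} [] z h = subst (EvaluatesTo x) (sym (++-identityʳ u)) h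
      appendLetters-evaluates {x} {u} (suc b ∷ w) z h =
        subst (EvaluatesTo (appendLetters x (suc b ∷ w)))
          (trans (cong (λ l → (u ++ l ∷ []) ++ w) (⊔ᴸ-zero (suc b))) (++-assoc u (suc b ∷ []) w))
          (appendLetters-evaluates w z (product-evaluates (⊣ b) h unit-evaluates))

      normalForm-evaluates : ∀ w → zeros w ≡ 1 → EvaluatesTo (normalForm w) w
      normalForm-evaluates (zero ∷ w)  z = appendLetters-evaluates w (suc-injective z) unit-evaluates
      normalForm-evaluates (suc a ∷ w) z = subst (EvaluatesTo (normalForm (suc a ∷ w)))
        (cong (_∷ w) (⊔ᴸ-zero (suc a)))
        (product-evaluates (⊢ a) unit-evaluates (normalForm-evaluates w z))

      subst-evaluates : ∀ {p n x} {w : Word γ n} (eq : p ≡ n) → EvaluatesTo (p , x) (proj₁ w) →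
                        e (subst Op eq x) D.≈ [ w ]
      subst-evaluates refl h = D.≈ᴹ-trans (equal h) (D.≈ᴹ-reflexive (cong [_] (word-≡ (letters h))))

    normalFormᵂ-section : ∀ {n} (w : Word γ n) → e (normalFormᵂ w) D.≈ [ w ]
    normalFormᵂ-section (w , _ , z) = subst-evaluates _ (normalForm-evaluates w z)

    normalize-section : ∀ {n} (y : D.Op n) → e (normalize y) D.≈ y
    normalize-section [ w ]   = normalFormᵂ-section w
    normalize-section 𝟎       = e-𝟘
    normalize-section (x ⊞ y) =
      D.≈ᴹ-trans (e-⊕ _ _) (D.+ᴹ-cong (normalize-section x) (normalize-section y))
    normalize-section (k ⊡ x) =
      D.≈ᴹ-trans (e-· k _) (D.*ₗ-cong (CommutativeRing.refl R) (normalize-section x))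

-- The quotient and its isomorphism with Dias

module Presentation (R : CommutativeRing c ℓ) (γ : ℕ) where
  private
    module R = CommutativeRing R
    module F = OperadProperties (Free R (𝔊 γ))
    module F′ = OperadProperties (Free R (𝔊′ γ))
    module D = OperadProperties (Dias R γ)
    module W = SetOperad (wordOperad γ)
    module ES = Evaluation (Dias R γ) (stands-for R {γ})

  Quotient : Operad R c (c ⊔ˡ ℓ)
  Quotient = Free R (𝔊′ γ) / ⟨ ℜ′ R {γ} ⟩

  private
    module Q = OperadProperties Quotient

  image : 𝔊′ γ → D.Op 1
  image g = ES.ev (primed R g)

  open Evaluation (Dias R γ) image

  -- The sum telescopes; the last difference is the last term itself, so no remainder is left.
  tailSum-differences : ∀ {n} (x : Fin n → F.Op 1) a → F.tailSum (differences R x) (toℕ a) F.≈ x a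
  tailSum-differences {suc zero}    x zero = ≃-trans (⊞-comm _ _) (⊞-idˡ _)
  tailSum-differences {suc (suc n)} x zero = ≃-trans
    (⊞-cong ≃-refl (tailSum-differences (x ∘ suc) zero))
    (≃-trans (⊞-assoc _ _ _) (≃-trans
      (⊞-cong ≃-refl (≃-trans (⊞-comm _ _) (⊞-invʳ R _))) (≃-trans (⊞-comm _ _) (⊞-idˡ _))))
  tailSum-differences {suc (suc n)} x (suc a) = tailSum-differences (x ∘ suc) a

  tailSum-image : ∀ (g : Fin γ → 𝔊 γ) a →
                  D.tailSum (λ b → ES.ev (differences R (λ c → generator R (g c)) b)) (toℕ a) D.≈ [ word (g a) ]
  tailSum-image g a = ≃-trans
    (≃-sym (tailSum-hom {M = F.component 1} {N = D.component 1} ES.ev ≃-refl (λ _ _ → ≃-refl)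
      (differences R (λ c → generator R (g c))) (toℕ a)))
    (≃-trans
    (ES.ev-cong (tailSum-differences (λ c → generator R (g c)) a))
    (ES.ev-generator (g a)))

  private
    tree-≡ : ∀ {n} {s t : Tree (𝔊′ γ) n} → proj₁ s ≡ proj₁ t → s ≡ t
    tree-≡ = Σ-prop-≡ ≡-irrelevant

    module RD = Relations (Dias R γ) image
    module RQ = Relations Quotient (generator R)

    -- The label `k` is kept apart from `a` because in the relations it is a max computed in ℕ.
    tail⊣ : ∀ {k} (a : Fin γ) → toℕ a ≡ k → RD.Tail⊣ k D.≈ [ word (⊣ a) ]
    tail⊣ a refl = tailSum-image ⊣ a

    tail⊢ : ∀ {k} (a : Fin γ) → toℕ a ≡ k → RD.Tail⊢ k D.≈ [ word (⊢ a) ]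
    tail⊢ a refl = tailSum-image ⊢ a

    compose : ∀ {x y x′ y′ : D.Op 1} {u v u′ v′ : Word γ 1} {i i′} →
              x D.≈ [ u ] → y D.≈ [ v ] → x′ D.≈ [ u′ ] → y′ D.≈ [ v′ ] →
              proj₁ (u W.∘[ i ] v) ≡ proj₁ (u′ W.∘[ i′ ] v′) → x D.∘[ i ] y D.≈ x′ D.∘[ i′ ] y′
    compose {i = i} {i′} e₁ e₂ e₃ e₄ h = ≃-trans (D.∘-cong i e₁ e₂)
      (≃-trans (D.≈ᴹ-reflexive (cong [_] (word-≡ h))) (≃-sym (D.∘-cong i′ e₃ e₄)))

  unprimedRelations : RD.UnprimedRelations
  unprimedRelations = record
    { ⊢∘₁⊢ = λ b a → let d , e , d≡ = suc-⊔ᴸ-suc b a in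
        compose (tail⊢ b refl) (tail⊢ a refl) (tail⊢ d d≡) (tail⊢ b refl)
          (cong₂ (λ x y → x ∷ y ∷ zero ∷ []) e (trans (⊔ᴸ-zero (suc b)) (sym (zero-⊔ᴸ (suc b)))))
    ; ⊢∘₁⊣ = λ b a → let d , e , d≡ = suc-⊔ᴸ-suc b a in
        compose (tail⊢ b refl) (tail⊣ a refl) (tail⊢ b refl) (tail⊢ d d≡)
          (cong₂ (λ x y → x ∷ y ∷ zero ∷ []) (⊔ᴸ-zero (suc b)) (trans e (sym (zero-⊔ᴸ (suc d)))))
    ; ⊣∘₂⊣ = λ b a → let d , e , d≡ = suc-⊔ᴸ-suc b a in
        compose (tail⊣ b refl) (tail⊣ a refl) (tail⊣ d d≡) (tail⊣ b refl)
          (cong₂ (λ x y → zero ∷ x ∷ y ∷ []) (trans (⊔ᴸ-zero (suc b)) (sym (zero-⊔ᴸ (suc b)))) e)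
    ; ⊣∘₂⊢ = λ b a → let d , e , d≡ = suc-⊔ᴸ-suc b a in
        compose (tail⊣ b refl) (tail⊢ a refl) (tail⊣ b refl) (tail⊣ d d≡)
          (cong₂ (λ x y → zero ∷ x ∷ y ∷ []) (trans e (sym (zero-⊔ᴸ (suc d)))) (⊔ᴸ-zero (suc b)))
    ; ⊣∘₁⊢ = λ a b → compose (tail⊣ a refl) (tail⊢ b refl) (tail⊢ b refl) (tail⊣ a refl)
        (cong (λ x → x ∷ zero ∷ suc a ∷ []) (zero-⊔ᴸ (suc b)))
    }

  primedRelations : RD.PrimedRelations
  primedRelations = RD.unprimed⇒primed unprimedRelations

  private
    infix 4 _↦_
    record _↦_ {n} (x : F′.Op n) (z : D.Op n) : Set (c ⊔ˡ ℓ) where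
      constructor maps
      field
        ev-≈ : ev x D.≈ z
    open _↦_

    ∘₁-↦ : ∀ g h → _∘₁_ R g h ↦ image g D.∘[ zero ] image h
    ∘₁-↦ g h = maps (≃-trans (ev-∘ (generator R g) zero (generator R h))
      (D.∘-cong zero (ev-generator g) (ev-generator h)))

    ∘₂-↦ : ∀ g h → _∘₂_ R g h ↦ image g D.∘[ suc zero ] image h
    ∘₂-↦ g h = maps (≃-trans (ev-∘ (generator R g) (suc zero) (generator R h))
      (D.∘-cong (suc zero) (ev-generator g) (ev-generator h)))

    ∑≥-↦ : ∀ a {x : Fin γ → F′.Op 2} {y} → (∀ b → x b ↦ y b) → ∑≥ R a x ↦ D.tailSum y (toℕ a)
    ∑≥-↦ a {x} {y} e = maps (≃-trans (ev-cong (F′.sum-guarded x a)) (≃-trans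
      (tailSum-hom {M = F′.component 2} {N = D.component 2} ev ≃-refl (λ _ _ → ≃-refl) x (toℕ a))
      (D.tailSum-cong (λ b → ev-≈ (e b)) (toℕ a))))

    null : ∀ {n} {x : F′.Op n} {z} → x ↦ z → z D.≈ D.𝟘 → ev x D.≈ D.𝟘
    null e = ≃-trans (ev-≈ e)

    difference : ∀ {n} {x y : F′.Op n} {z w} → x ↦ z → y ↦ w → z D.≈ w → ev (x F′.⊖ y) D.≈ D.𝟘
    difference e e′ h = ≃-trans (⊞-cong (≃-trans (ev-≈ e) (≃-trans h (≃-sym (ev-≈ e′)))) ≃-refl) (⊞-invʳ R _)

  open D.Triangular

  ev-ℜ′ : ∀ {n x} → ℜ′ R n x → ev x D.≈ D.𝟘
  ev-ℜ′ = let open RD.PrimedRelations primedRelations in λ where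
    (⊣∘₁⊢-⊢∘₂⊣ a b) → difference (∘₁-↦ (⊣′ a) (⊢′ b)) (∘₂-↦ (⊢′ b) (⊣′ a)) (⊣∘₁⊢ a b)
    (⊢∘₁⊢-null {a} {b} a<b) → null (∘₁-↦ (⊢′ b) (⊢′ a)) (below ⊢∘₁⊢ a<b)
    (⊣∘₂⊣-null {a} {b} a<b) → null (∘₂-↦ (⊣′ b) (⊣′ a)) (below ⊣∘₂⊣ a<b)
    (⊢∘₁⊣-null {a} {b} a<b) → null (∘₁-↦ (⊢′ b) (⊣′ a)) (below ⊢∘₁⊣ a<b)
    (⊣∘₂⊢-null {a} {b} a<b) → null (∘₂-↦ (⊣′ b) (⊢′ a)) (below ⊣∘₂⊢ a<b)
    (⊢∘₁⊢-⊢∘₂⊢ {a} {b} a<b) →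
      difference (∘₁-↦ (⊢′ a) (⊢′ b)) (∘₂-↦ (⊢′ b) (⊢′ a)) (above ⊢∘₁⊢ a<b)
    -- For ⊣, the triangular systems rewrite `∘₂` composites, whereas `ℜ′` lists the `∘₁` side
    -- first; hence the reversals.
    (⊣∘₁⊣-⊣∘₂⊣ {a} {b} a<b) →
      difference (∘₁-↦ (⊣′ b) (⊣′ a)) (∘₂-↦ (⊣′ a) (⊣′ b)) (≃-sym (above ⊣∘₂⊣ a<b))
    (⊢∘₁⊣-⊢∘₂⊢ {a} {b} a<b) →
      difference (∘₁-↦ (⊢′ a) (⊣′ b)) (∘₂-↦ (⊢′ a) (⊢′ b)) (above ⊢∘₁⊣ a<b)
    (⊣∘₁⊣-⊣∘₂⊢ {a} {b} a<b) →
      difference (∘₁-↦ (⊣′ a) (⊣′ b)) (∘₂-↦ (⊣′ a) (⊢′ b)) (≃-sym (above ⊣∘₂⊢ a<b))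
    (⊢∘₁⊢-∑⊢∘₂⊢ a) →
      difference (∘₁-↦ (⊢′ a) (⊢′ a)) (∑≥-↦ a λ b → ∘₂-↦ (⊢′ a) (⊢′ b)) (diagonal ⊢∘₁⊢ a)
    (∑⊣∘₁⊣-⊣∘₂⊣ a) →
      difference (∑≥-↦ a λ b → ∘₁-↦ (⊣′ a) (⊣′ b)) (∘₂-↦ (⊣′ a) (⊣′ a)) (≃-sym (diagonal ⊣∘₂⊣ a))
    (⊢∘₁⊣-∑⊢∘₂⊢ a) →
      difference (∘₁-↦ (⊢′ a) (⊣′ a)) (∑≥-↦ a λ b → ∘₂-↦ (⊢′ b) (⊢′ a)) (diagonal ⊢∘₁⊣ a)
    (∑⊣∘₁⊣-⊣∘₂⊢ a) →
      difference (∑≥-↦ a λ b → ∘₁-↦ (⊣′ b) (⊣′ a)) (∘₂-↦ (⊣′ a) (⊢′ a)) (≃-sym (diagonal ⊣∘₂⊢ a))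

  ev-⟨ℜ′⟩ : ∀ {n x} → Generated {O = Free R (𝔊′ γ)} (ℜ′ R {γ}) n x → ev x D.≈ D.𝟘
  ev-⟨ℜ′⟩ (gen r)          = ev-ℜ′ r
  ev-⟨ℜ′⟩ (resp e h)       = ≃-trans (≃-sym (ev-cong e)) (ev-⟨ℜ′⟩ h)
  ev-⟨ℜ′⟩ 𝟘∈               = ≃-refl
  ev-⟨ℜ′⟩ (⊕∈ h h′)        = ≃-trans (⊞-cong (ev-⟨ℜ′⟩ h) (ev-⟨ℜ′⟩ h′)) (⊞-idˡ 𝟎)
  ev-⟨ℜ′⟩ (·∈ k h)         = ≃-trans (⊡-cong R.refl (ev-⟨ℜ′⟩ h)) (⊡-zeroʳ R k)
  ev-⟨ℜ′⟩ (∘ˡ∈ {x = x} i y h) =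
    ≃-trans (ev-∘ x i y) (≃-trans (D.∘-cong i (ev-⟨ℜ′⟩ h) (≃-refl {x = ev y})) (D.∘-zeroˡ i (ev y)))
  ev-⟨ℜ′⟩ (∘ʳ∈ x i {y} h)  =
    ≃-trans (ev-∘ x i y) (≃-trans (D.∘-cong i (≃-refl {x = ev x}) (ev-⟨ℜ′⟩ h)) (D.∘-zeroʳ (ev x) i))

  ev-cong-Q : ∀ {n} {x y : Q.Op n} → x Q.≈ y → ev x D.≈ ev y
  ev-cong-Q {n} h = x∙y⁻¹≈ε⇒x≈y _ _ (ev-⟨ℜ′⟩ h)
    where open AbelianGroupProperties (D.Comp.+ᴹ-abelianGroup {n}) using (x∙y⁻¹≈ε⇒x≈y)

  private
    null-Q : ∀ {n} {x : F′.Op n} → ℜ′ R n x → x Q.≈ Q.𝟘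
    null-Q {x = x} r = resp (≃-sym (≃-trans (⊞-cong ≃-refl (⊡-zeroʳ R _)) (≃-trans (⊞-comm x 𝟎) (⊞-idˡ x)))) (gen r)

  -- Membership of `x ⊖ y` in the ideal is by definition equality of `x` and `y` in the quotient, so
  -- each two-sided generator of the ideal is already the required equation.
  primedRelations-Q : RQ.PrimedRelations
  primedRelations-Q = record
    { ⊢∘₁⊢ = record
      { below    = λ a<b → null-Q (⊢∘₁⊢-null a<b)
      ; above    = λ a<b → gen (⊢∘₁⊢-⊢∘₂⊢ a<b)
      ; diagonal = λ a → Q.≈ᴹ-trans (gen (⊢∘₁⊢-∑⊢∘₂⊢ a)) (Q.sum-guarded _ a) }
    ; ⊢∘₁⊣ = record
      { below    = λ a<b → null-Q (⊢∘₁⊣-null a<b)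
      ; above    = λ a<b → gen (⊢∘₁⊣-⊢∘₂⊢ a<b)
      ; diagonal = λ a → Q.≈ᴹ-trans (gen (⊢∘₁⊣-∑⊢∘₂⊢ a)) (Q.sum-guarded _ a) }
    ; ⊣∘₂⊣ = record
      { below    = λ a<b → null-Q (⊣∘₂⊣-null a<b)
      ; above    = λ a<b → Q.≈ᴹ-sym (gen (⊣∘₁⊣-⊣∘₂⊣ a<b))
      ; diagonal = λ a → Q.≈ᴹ-trans (Q.≈ᴹ-sym (gen (∑⊣∘₁⊣-⊣∘₂⊣ a))) (Q.sum-guarded _ a) }
    ; ⊣∘₂⊢ = record
      { below    = λ a<b → null-Q (⊣∘₂⊢-null a<b)
      ; above    = λ a<b → Q.≈ᴹ-sym (gen (⊣∘₁⊣-⊣∘₂⊢ a<b))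
      ; diagonal = λ a → Q.≈ᴹ-trans (Q.≈ᴹ-sym (gen (∑⊣∘₁⊣-⊣∘₂⊢ a))) (Q.sum-guarded _ a) }
    ; ⊣∘₁⊢ = λ a b → gen (⊣∘₁⊢-⊢∘₂⊣ a b)
    }

  private
    module N = NormalForms Quotient (generator R) (RQ.primed⇒unprimed primedRelations-Q)

  transports-generator : ∀ g → N.Transports (image g) (generator R g)
  transports-generator = N.transports-letters image (λ a → tail⊣ a refl) (λ a → tail⊢ a refl)

  -- This presents a node as the product of its subtrees by a generator, which is what `Transports`
  -- speaks about.
  graft-corolla : ∀ g (l r : BinTree (𝔊′ γ)) {k} → k ≡ suc (nodes l) →
                  graft (graft (proj₁ (corolla g)) 0 l) k r ≡ node g l r
  graft-corolla g l r {k} refl with suc (nodes l) ≤? nodes l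
  ... | yes h = contradiction h (<⇒≱ (n<1+n (nodes l)))
  ... | no _  = refl

  -- Induction on the tree: a node evaluates to a product by `image g`, and normalization turns it
  -- into the product by the generator `g` in the quotient.
  normalize-evalTree : ∀ t → N.normalize (evalTree (Dias R γ) image t) Q.≈ [ t , refl ]
  normalize-evalTree leaf         = Q.≈ᴹ-refl
  normalize-evalTree (node g l r) = subst (λ t → N.normalize (evalTree (Dias R γ) image (node g l r)) Q.≈ [ t ])
    (tree-≡ (graft-corolla g l r (Fin.toℕ-fromℕ (suc (nodes l)))))
    (N.normalize-product (transports-generator g) (evalTree (Dias R γ) image l) (evalTree (Dias R γ) image r)
      {[ l , refl ]} {[ r , refl ]} (normalize-evalTree l) (normalize-evalTree r))

  normalize-ev : ∀ {n} (x : F′.Op n) → N.normalize (ev x) Q.≈ x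
  normalize-ev [ t , refl ] = normalize-evalTree t
  normalize-ev 𝟎            = Q.≈ᴹ-refl
  normalize-ev (x ⊞ y)      = Q.+ᴹ-cong (normalize-ev x) (normalize-ev y)
  normalize-ev (k ⊡ x)      = Q.*ₗ-cong R.refl (normalize-ev x)

  ev-injective : ∀ {n} {x y : F′.Op n} → ev x D.≈ ev y → x Q.≈ y
  ev-injective {x = x} {y} = N.normalize-separates {x = ev x} {ev y} {x} {y} (normalize-ev x) (normalize-ev y)

  ev-unprimed : ∀ u → ev (N.unprimed u) D.≈ [ word u ]
  ev-unprimed = λ where
      (⊣ a) → ≃-trans (ev-tail ⊣′ a) (tail⊣ a refl)
      (⊢ a) → ≃-trans (ev-tail ⊢′ a) (tail⊢ a refl)
    where
    ev-tail : ∀ (s : Fin γ → 𝔊′ γ) (a : Fin γ) →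
              ev (Q.tailSum (generator R ∘ s) (toℕ a)) D.≈ D.tailSum (image ∘ s) (toℕ a)
    ev-tail s a = ≃-trans
      (tailSum-hom {M = Q.component 1} {N = D.component 1} ev ≃-refl (λ _ _ → ≃-refl) (generator R ∘ s) (toℕ a))
      (D.tailSum-cong (λ b → ev-generator (s b)) (toℕ a))

  ev-normalize : ∀ {n} (y : D.Op n) → ev (N.normalize y) D.≈ y
  ev-normalize = N.normalize-section (λ {n} → ev {n}) (λ {p} {q} → ev-∘ {p} {q})
    ≃-refl ≃-refl (λ _ _ → ≃-refl) (λ _ _ → ≃-refl) ev-unprimed

  private
    module FM {n : ℕ} = LeftModuleMorphisms (LeftModule.rawLeftModule (Q.component n))
                                            (LeftModule.rawLeftModule (D.component n))

  ev-homomorphism : ∀ n → FM.IsLeftModuleHomomorphism (ev {n})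
  ev-homomorphism n = record
    { +ᴹ-isGroupHomomorphism = record
      { isMonoidHomomorphism = record
        { isMagmaHomomorphism = record
          { isRelHomomorphism = record { cong = ev-cong-Q }
          ; homo = λ _ _ → ≃-refl }
        ; ε-homo = ≃-refl }
      ; ⁻¹-homo = λ _ → ≃-refl }
    ; *ₗ-homo = λ _ _ → ≃-refl }

  ev-fibre : ∀ {n} (x : Q.Op n) {y : D.Op n} → ev x D.≈ y → ∀ {z} → z Q.≈ x → ev z D.≈ y
  ev-fibre x h {z} e = ≃-trans (ev-cong-Q {x = z} {x} e) h

  ev-surjective : ∀ {n} (y : D.Op n) → Σ[ x ∈ Q.Op n ] (∀ {z} → z Q.≈ x → ev z D.≈ y)
  ev-surjective y = N.normalize y , ev-fibre (N.normalize y) (ev-normalize y)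

  ev-isomorphism : ∀ n → FM.IsLeftModuleIsomorphism (ev {n})
  ev-isomorphism n = record
    { isLeftModuleMonomorphism = record
      { isLeftModuleHomomorphism = ev-homomorphism n
      ; injective = ev-injective }
    ; surjective = ev-surjective }

  presentation : AdmitsPresentation R (Dias R γ) image (ℜ′ R {γ})
  presentation = record
    { to          = ev
    ; isLinearIso = ev-isomorphism
    ; to-∘        = ev-∘
    ; to-id       = ≃-refl
    } , ev-generator

proposition2p3p8 : ∀ {c ℓ₁ ℓ₂} (K : HeytingField c ℓ₁ ℓ₂) → CharacteristicZero K → (γ : ℕ) →
    let R = groundRing K in
    AdmitsPresentation R (Dias R γ)
    (λ g → eval (Dias R γ) (stands-for R) (primed R g))
    (ℜ′ R {γ})
proposition2p3p8 K _ γ = Presentation.presentation (groundRing K) γ
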